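{- Let $t\ge2$ be an integer and set $\mathbf{e}=(1,2,\ldots,t)$. There is a bijection $\varphi: SC_{(t+1)} \times DD_{(t+1)}\to \mathbb{Z}^t$ such that for every pair $(\lambda,\mu)$, writing $\varphi(\lambda,\mu)=\mathbf{n}=(n_1,\ldots,n_t)$, one has \[ |\lambda|+|\mu|=(t+1) \|\mathbf{n}\|^2 +\mathbf{e} \cdot \mathbf{n} = \sum_{i=1}^t\big((t+1)n_i^2+i\,n_i\big), \] and, for every $i\in\{1,\ldots,t\}$, \[ t+1+\Delta_i= \sigma_i \big((2t+2)n_i+i\big), \] where $\sigma_i=1$ if $n_i\ge0$ and $\sigma_i=-1$ if $n_i<0$.
   Context: A partition $\lambda=(\lambda_1\ge\dots\ge\lambda_\ell>0)$ has weight $|\lambda|=\sum_i\lambda_i$, conjugate $\lambda'$, hook lengths $h(i,j)=\lambda_i-j+\lambda'_j-i+1$ for boxes $(i,j)$, $1\le j\le \lambda_i$; the principal hook lengths are $h(i,i)$ for the indices $i$ with $\lambda_i\ge i$. For a positive integer $s$, an $s$-core is a partition none of whose hook lengths is divisible by $s$. Self-conjugate means $\lambda=\lambda'$. A doubled distinct partition is either empty or, for integers $a_1>\dots>a_d\ge1$, the partition with exactly $d$ indices $i$ with $\lambda_i\ge i$ and with $\lambda_i-i=a_i$, $\lambda'_i-i=a_i-1$ for $1\le i\le d$. $SC_{(s)}$ (resp. $DD_{(s)}$) is the set of self-conjugate (resp. doubled distinct) $s$-cores. $\|\cdot\|$ is the Euclidean norm and $\cdot$ the standard scalar product. For $(\lambda,\mu)\in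 SC_{(t+1)}\times DD_{(t+1)}$, $\Delta$ denotes the set consisting of the principal hook lengths of $\lambda$ together with those of $\mu$, and for $i\in\{1,\dots,t\}$, $\Delta_i:=\max\big(\{h\in\Delta : h\equiv i-t-1 \text{ or } h\equiv -i-t-1 \pmod{2t+2}\}\cup\{i-t-1\}\big)$. -}

module Defs where

open import Data.Nat as ℕ using (ℕ; zero; suc; _≤_; _<_; _∸_; _≤?_)
open import Data.Nat.Divisibility using (_∣_)
open import Data.Nat.ListAction using (sum)
open import Data.Integer as ℤ using (ℤ; _⊔_)
import Data.Integer.Properties as ℤP
open import Data.Integer.DivMod using (_%ℕ_)
open import Data.List as List using (List; []; _∷_; length; filter; upTo; applyUpTo; _++_)
open import Data.List.Relation.Unary.All using (All)
open import Data.List.Relation.Unary.Linked using (Linked)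
open import Data.Vec as Vec using (Vec)
open import Data.Fin using (Fin; toℕ)
open import Data.Product using (Σ; ∃; _×_; _,_; proj₁; proj₂)
open import Data.Sum using (_⊎_)
open import Relation.Nullary using (¬_)
open import Relation.Binary.PropositionalEquality using (_≡_)
open import Relation.Nullary.Decidable using (_⊎-dec_)
open import Data.Bool using (if_then_else_)
open import Relation.Nullary.Decidable using (does)

IsPartition : List ℕ → Set
IsPartition l = Linked ℕ._≥_ l × All (0 <_) l

-- λ_i (1-indexed); 0 for i = 0 or i > ℓ.
part : List ℕ → ℕ → ℕ
part []       _             = 0
part (x ∷ xs) zero          = 0
part (x ∷ xs) (suc zero)    = x
part (x ∷ xs) (suc (suc i)) = part xs (suc i)

weight : List ℕ → ℕ
weight = sum

conj : List ℕ → ℕ → ℕ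
conj l j = length (filter (j ≤?_) l)

-- hook length h(i,j) = λ_i - j + λ'_j - i + 1 (for boxes (i,j), so nonnegative summands)
hook : List ℕ → ℕ → ℕ → ℕ
hook l i j = suc ((part l i ∸ j) ℕ.+ (conj l j ∸ i))

IsBox : List ℕ → ℕ → ℕ → Set
IsBox l i j = 1 ≤ i × i ≤ length l × 1 ≤ j × j ≤ part l i

IsCore : ℕ → List ℕ → Set
IsCore s l = ∀ i j → IsBox l i j → ¬ (s ∣ hook l i j)

IsSelfConj : List ℕ → Set
IsSelfConj l = ∀ j → 1 ≤ j → part l j ≡ conj l j

diagIdx : List ℕ → List ℕ
diagIdx l = filter (λ i → i ≤? part l i) (applyUpTo suc (length l))

IsDoubledDistinct : List ℕ → Set
IsDoubledDistinct l =
  l ≡ [] ⊎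
  (Σ ℕ λ d → Σ (Fin d → ℕ) λ a →
     (∀ (p q : Fin d) → toℕ p < toℕ q → a q < a p)
   × (∀ (p : Fin d) → 1 ≤ a p)
   × length (diagIdx l) ≡ d
   × (∀ (p : Fin d) → ℤ.+ part l (suc (toℕ p)) ℤ.- ℤ.+ suc (toℕ p) ≡ ℤ.+ a p
                    × ℤ.+ conj l (suc (toℕ p)) ℤ.- ℤ.+ suc (toℕ p) ≡ ℤ.+ a p ℤ.- ℤ.+ 1))

IsSC : ℕ → List ℕ → Set
IsSC s l = IsPartition l × IsCore s l × IsSelfConj l

IsDD : ℕ → List ℕ → Set
IsDD s l = IsPartition l × IsCore s l × IsDoubledDistinct l

SCDD : ℕ → Set
SCDD t = Σ (List ℕ × List ℕ) λ p → IsSC (suc t) (proj₁ p) × IsDD (suc t) (proj₂ p)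

principalHooks : List ℕ → List ℕ
principalHooks l = List.map (λ i → hook l i i) (diagIdx l)

Delta : (t : ℕ) → List ℕ → List ℕ → ℕ → ℤ
Delta t l m i = List.foldr _⊔_ base (List.map ℤ.+_ (filter sel (principalHooks l ++ principalHooks m)))
  where
  base : ℤ
  base = ℤ.+ i ℤ.- ℤ.+ suc t
  M : ℕ
  M = suc (suc (t ℕ.+ t))
  sel : (h : ℕ) → _
  sel h = ((ℤ.+ h) %ℕ M ℕ.≟ base %ℕ M) ⊎-dec ((ℤ.+ h) %ℕ M ℕ.≟ (ℤ.- ℤ.+ i ℤ.- ℤ.+ suc t) %ℕ M)

sgn : ℤ → ℤ
sgn n = if does (ℤ.+ 0 ℤP.≤? n) then ℤ.+ 1 else ℤ.- ℤ.+ 1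

quadForm : (t : ℕ) → Vec ℤ t → ℤ
quadForm t n = List.foldr ℤ._+_ (ℤ.+ 0)
  (Vec.toList (Vec.tabulate {n = t} λ p →
     ℤ.+ suc t ℤ.* (Vec.lookup n p ℤ.* Vec.lookup n p) ℤ.+ ℤ.+ suc (toℕ p) ℤ.* Vec.lookup n p))

{-# OPTIONS --safe #-}
-- Put s = t + 1. A self-conjugate partition has Frobenius coordinates (a | a) and
-- odd principal hooks 2a + 1, a doubled distinct one has coordinates (a | a − 1)
-- and even principal hooks 2a; both are recovered from their principal hooks,
-- whose sum is the weight. Hook lengths are the distances from a bead down to a
-- hole of the boundary word, so the s-core condition on both partitions says that
-- the set Δ of all principal hooks satisfies: h + 2s ∈ Δ implies h ∈ Δ, no two
-- elements of Δ add up to 2s, and 0 ∉ Δ. Hence Δ meets each residue class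
-- modulo 2s in an initial segment, is disjoint from the classes of 0 and s, and for
-- 1 ≤ i ≤ t meets at most one of the classes of s + i and s − i. The integer n_i is
-- the number of elements in the first class minus the number in the second.
module Submission where

open import Defs

-- An arm `a` in a partition of type `e` (`e = 1` self-conjugate, `e = 0` doubled distinct) gives
-- the principal hook `e + 2a`, so steps of `s` between arms become steps of `2s` between hooks. The
-- row with arm `a` crosses the column under the diagonal box with arm `b` in a hook of length
-- `e + a + b`. Hence two principal hooks of equal parity add up to `2s` exactly when this length is
-- `s`, while hooks of different parity have an odd sum: the conditions on the two partitions become
-- conditions on one set without interfering.
--
-- A class `r, r + 2s, ...` with `c` elements has the sum `c r + s c (c - 1)`. For `r = s + i` this
-- is `s c^2 + i c` and for `r = s - i` it is `s c^2 - i c`, the summand at `n_i = c` and at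
-- `n_i = -c`. The last element is `2sc + i - s` or `2sc - i - s`; the default `i - s` in `Delta` is
-- the first expression at `c = 0`.
--
-- The weight is computed only for partitions built from a list of arms; the bijection then carries
-- the formula to every pair.

module Cores where

  open import Data.Bool using (if_then_else_)
  open import Data.Empty using (⊥; ⊥-elim)
  open import Data.Fin as Fin using (Fin; toℕ; fromℕ<)
  open import Data.Fin.Properties using (toℕ<n; toℕ-fromℕ<)
  open import Data.Integer using (ℤ; -[1+_]; ∣_∣; _⊖_; _⊔_; -_; -≤+)
    renaming (+_ to pos; _+_ to _ℤ+_; _-_ to _ℤ-_; _*_ to _ℤ*_; _≤_ to _ℤ≤_; +≤+ to pos≤pos)
  open import Data.Integer.DivMod using (_%ℕ_)
  import Data.Integer.Properties as ℤP
  open import Data.Integer.Tactic.RingSolver using () renaming (solve-∀ to solve-ℤ)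
  open import Data.List using (List; []; _∷_; _++_; length; filter; map; foldr; applyUpTo; downFrom)
  open import Data.List.Membership.Propositional using (_∈_)
  open import Data.List.Membership.Propositional.Properties
    using (∈-++⁺ˡ; ∈-++⁺ʳ; ∈-++⁻; ∈-filter⁺; ∈-filter⁻; ∈-map∘filter⁺; ∈-map∘filter⁻;
           ∈-applyUpTo⁺; ∈-applyUpTo⁻; ∈-downFrom⁺)
  open import Data.List.Properties using (filter-accept; filter-reject)
  open import Data.List.Relation.Unary.All as All using (All; []; _∷_)
  open import Data.List.Relation.Unary.Any using (here; there)
  open import Data.List.Relation.Unary.Linked as Linked using (Linked; []; [-]; _∷_)
  open import Data.List.Relation.Unary.Linked.Properties using (applyDownFrom⁺₂)
    renaming (filter⁺ to linked-filter⁺)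
  open import Data.Nat hiding (_⊔_)
  open import Data.Nat.Divisibility using (divides; divides-refl)
  open import Data.Nat.DivMod
  open import Data.Nat.Induction using (<-rec)
  open import Data.Nat.ListAction using (sum)
  open import Data.Nat.Properties
  open import Data.List.Membership.DecPropositional _≟_ using (_∈?_)
  open import Data.Nat.Tactic.RingSolver using (solve-∀)
  open import Data.Product using (∃; _×_; _,_; proj₁; proj₂)
  open import Data.Sum using (_⊎_; inj₁; inj₂; [_,_]′)
  open import Data.Vec using (Vec; []; _∷_; lookup; tabulate; toList)
  open import Data.Vec.Properties using (tabulate∘lookup; tabulate-cong)
  open import Function using (_∘_; id; flip)
  open import Relation.Binary using (tri<; tri≈; tri>)
  open import Relation.Binary.PropositionalEquality
  open import Relation.Nullary using (¬_; yes; no; does; contradiction)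
  open import Relation.Nullary.Decidable using (map′; dec-true; dec-false)
  open import Relation.Unary using (Decidable; _⊆_)

  -- Rows, columns and hooks

  Decreasing : List ℕ → Set
  Decreasing = Linked _≥_

  part-≤-head : ∀ {x xs} → Decreasing (x ∷ xs) → ∀ i → part xs i ≤ x
  part-≤-head [-]      i             = z≤n
  part-≤-head (_ ∷ _)  zero          = z≤n
  part-≤-head (h ∷ _)  (suc zero)    = h
  part-≤-head (h ∷ hs) (suc (suc i)) = ≤-trans (part-≤-head hs (suc i)) h

  part-antitone : ∀ {l} → Decreasing l → ∀ {i j} → 1 ≤ i → i ≤ j → part l j ≤ part l i
  part-antitone {[]}     _ _ _ = z≤n
  part-antitone {x ∷ xs} D {suc zero}    {suc zero}    _ _ = ≤-refl
  part-antitone {x ∷ xs} D {suc zero}    {suc (suc j)} _ _ = part-≤-head D (suc j)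
  part-antitone {x ∷ xs} D {suc (suc i)} {suc (suc j)} _ (s≤s le) =
    part-antitone (Linked.tail D) (s≤s z≤n) le

  part-pos⇒≤-length : ∀ l i → 1 ≤ part l i → i ≤ length l
  part-pos⇒≤-length (x ∷ xs) (suc zero)    _ = s≤s z≤n
  part-pos⇒≤-length (x ∷ xs) (suc (suc i)) p = s≤s (part-pos⇒≤-length xs (suc i) p)

  ≤-length⇒part-pos : ∀ {l} → All (0 <_) l → ∀ {i} → 1 ≤ i → i ≤ length l → 1 ≤ part l i
  ≤-length⇒part-pos (p ∷ _)  {suc zero}    _ _        = p
  ≤-length⇒part-pos (_ ∷ ps) {suc (suc i)} _ (s≤s le) = ≤-length⇒part-pos ps (s≤s z≤n) le

  conj-∷-≤ : ∀ {x xs j} → j ≤ x → conj (x ∷ xs) j ≡ suc (conj xs j)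
  conj-∷-≤ {j = j} j≤x = cong length (filter-accept (j ≤?_) j≤x)

  conj-∷-> : ∀ {x xs j} → x < j → conj (x ∷ xs) j ≡ conj xs j
  conj-∷-> {j = j} x<j = cong length (filter-reject (j ≤?_) (<⇒≱ x<j))

  conj-≡0 : ∀ {x xs j} → Decreasing (x ∷ xs) → x < j → conj (x ∷ xs) j ≡ 0
  conj-≡0 {xs = []}     D       x<j = conj-∷-> x<j
  conj-≡0 {xs = y ∷ ys} (h ∷ D) x<j = trans (conj-∷-> x<j) (conj-≡0 D (≤-<-trans h x<j))

  -- With `conj⇒part`, rows and columns describe the same boxes. Everything later uses `conj` only
  -- through this pair.
  part⇒conj : ∀ {l} → Decreasing l → ∀ {i j} → 1 ≤ i → 1 ≤ j → j ≤ part l i → i ≤ conj l j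
  part⇒conj {[]} _ _ 1≤j j≤p = contradiction (≤-trans 1≤j j≤p) λ ()
  part⇒conj {x ∷ xs} D {suc zero} _ 1≤j j≤p = subst (1 ≤_) (sym (conj-∷-≤ j≤p)) (s≤s z≤n)
  part⇒conj {x ∷ xs} D {suc (suc i)} _ 1≤j j≤p =
    subst (suc (suc i) ≤_) (sym (conj-∷-≤ (≤-trans j≤p (part-≤-head D (suc i)))))
      (s≤s (part⇒conj (Linked.tail D) (s≤s z≤n) 1≤j j≤p))

  conj⇒part : ∀ {l} → Decreasing l → ∀ {i j} → 1 ≤ i → i ≤ conj l j → j ≤ part l i
  conj⇒part {[]} _ 1≤i i≤c = contradiction (≤-trans 1≤i i≤c) λ ()
  conj⇒part {x ∷ xs} D {i} {j} 1≤i i≤c with j ≤? x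
  conj⇒part {x ∷ xs} D {suc zero}    1≤i i≤c | yes j≤x = j≤x
  conj⇒part {x ∷ xs} D {suc (suc i)} 1≤i i≤c | yes j≤x =
    conj⇒part (Linked.tail D) (s≤s z≤n) (s≤s⁻¹ (subst (suc (suc i) ≤_) (conj-∷-≤ j≤x) i≤c))
  conj⇒part {x ∷ xs} D {i} 1≤i i≤c | no j≰x =
    contradiction (≤-trans 1≤i (subst (i ≤_) (conj-≡0 D (≰⇒> j≰x)) i≤c)) λ ()

  ≤-extensional : ∀ {m n} → (∀ i → 1 ≤ i → i ≤ m → i ≤ n) → (∀ i → 1 ≤ i → i ≤ n → i ≤ m) → m ≡ n
  ≤-extensional f g = ≤-antisym (half f) (half g)
    where
    half : ∀ {m n} → (∀ i → 1 ≤ i → i ≤ m → i ≤ n) → m ≤ n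
    half {zero}  _ = z≤n
    half {suc m} f = f (suc m) (s≤s z≤n) ≤-refl

  conj-unique : ∀ {l} → Decreasing l → ∀ {j c} → 1 ≤ j →
    (∀ i → 1 ≤ i → i ≤ c → j ≤ part l i) → (∀ i → 1 ≤ i → j ≤ part l i → i ≤ c) → conj l j ≡ c
  conj-unique D 1≤j f g = ≤-extensional
    (λ i 1≤i i≤c → g i 1≤i (conj⇒part D 1≤i i≤c))
    (λ i 1≤i i≤c → part⇒conj D 1≤i 1≤j (f i 1≤i i≤c))

  part-ext : ∀ {l m} → All (0 <_) l → All (0 <_) m → (∀ i → 1 ≤ i → part l i ≡ part m i) → l ≡ m
  part-ext []      []      _  = refl
  part-ext []      (q ∷ _) eq = contradiction (subst (0 <_) (sym (eq 1 (s≤s z≤n))) q) λ ()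
  part-ext (p ∷ _) []      eq = contradiction (subst (0 <_) (eq 1 (s≤s z≤n)) p) λ ()
  part-ext (p ∷ ps) (q ∷ qs) eq =
    cong₂ _∷_ (eq 1 (s≤s z≤n)) (part-ext ps qs λ { (suc i) _ → eq (suc (suc i)) (s≤s z≤n) })

  -- Row i carries the bead part i − i, column j the hole j − 1 − conj j.
  bead≢hole : ∀ {l} → Decreasing l → ∀ {i j} → 1 ≤ i → 1 ≤ j → suc (part l i + conj l j) ≢ i + j
  bead≢hole {l} D {i} {j} 1≤i 1≤j eq with j ≤? part l i
  ... | yes j≤p = <-irrefl (trans (+-comm j i) (sym eq))
                    (s≤s (+-mono-≤ j≤p (part⇒conj D 1≤i 1≤j j≤p)))
  ... | no j≰p with i ≤? conj l j
  ... | yes i≤c = j≰p (conj⇒part D 1≤i i≤c)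
  ... | no i≰c  = <-irrefl (trans eq (+-comm i j))
    (≤-trans (≤-reflexive (cong suc (sym (+-suc _ _)))) (+-mono-≤ (≰⇒> j≰p) (≰⇒> i≰c)))

  -- Written additively, so that only rows reaching the diagonal qualify: these are the nonnegative
  -- beads, that is, the arm lengths of the diagonal boxes. `Hole` collects the nonnegative holes in
  -- the same way.
  Arm : List ℕ → ℕ → Set
  Arm l a = ∃ λ i → 1 ≤ i × part l i ≡ a + i

  Hole : List ℕ → ℕ → Set
  Hole l b = ∃ λ j → 1 ≤ j × suc (b + conj l j) ≡ j

  ¬arm×hole : ∀ {l} → Decreasing l → ∀ {a} → Arm l a → Hole l a → ⊥
  ¬arm×hole {l} D {a} (i , 1≤i , p) (j , 1≤j , c) = bead≢hole D 1≤i 1≤j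
    (begin
      suc (part l i + conj l j) ≡⟨ cong (λ u → suc (u + conj l j)) p ⟩
      suc (a + i + conj l j)    ≡⟨ rearrange a i (conj l j) ⟩
      i + suc (a + conj l j)    ≡⟨ cong (i +_) c ⟩
      i + j ∎)
    where
    open ≡-Reasoning
    rearrange : ∀ a i c → suc (a + i + c) ≡ i + suc (a + c)
    rearrange = solve-∀

  -- The first row whose bead is at most `a` decides. Equality gives an arm; otherwise, if `i` rows
  -- precede it, column `a + i + 1` has exactly `i` boxes and is the hole `a`.
  arm⊎hole : ∀ {l} → Decreasing l → ∀ a → Arm l a ⊎ Hole l a
  arm⊎hole {l} D a = search (part l 1) 0 (m≤m+n _ 0) (inj₁ refl)
    where
    search : ∀ fuel i → part l 1 ≤ fuel + i → i ≡ 0 ⊎ (1 ≤ i × a + i < part l i) → Arm l a ⊎ Hole l a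
    search fuel i bound below with <-cmp (part l (suc i)) (a + suc i)
    ... | tri≈ _ eq _ = inj₁ (suc i , s≤s z≤n , eq)
    ... | tri< lt _ _ = inj₂ (suc (a + i) , s≤s z≤n , cong (λ c → suc (a + c)) conj≡i)
      where
      lt′ : part l (suc i) < suc (a + i)
      lt′ = subst (part l (suc i) <_) (+-suc a i) lt
      i≤conj : i ≡ 0 ⊎ (1 ≤ i × a + i < part l i) → i ≤ conj l (suc (a + i))
      i≤conj (inj₁ refl)      = z≤n
      i≤conj (inj₂ (1≤i , b)) = part⇒conj D 1≤i (s≤s z≤n) b
      conj≡i : conj l (suc (a + i)) ≡ i
      conj≡i = ≤-antisym (≮⇒≥ λ i<c → <⇒≱ lt′ (conj⇒part D (s≤s z≤n) i<c)) (i≤conj below)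
    -- Here `i` is at least the length of the first row, so no row can be longer than `a + suc i`.
    search zero i bound below | tri> _ _ gt =
      contradiction (≤-trans gt (≤-trans (part-antitone D ≤-refl (s≤s z≤n)) bound))
        (<⇒≱ (s≤s (≤-trans (n≤1+n i) (m≤n+m (suc i) a))))
    search (suc fuel) i bound below | tri> _ _ gt =
      search fuel (suc i) (subst (part l 1 ≤_) (sym (+-suc fuel i)) bound) (inj₂ (s≤s z≤n , gt))

  box-split : ∀ {l} → Decreasing l → ∀ {i j} → 1 ≤ i → 1 ≤ j → j ≤ part l i →
    ∃ λ u → ∃ λ v → part l i ≡ u + j × conj l j ≡ v + i × hook l i j ≡ suc (u + v)
  box-split {l} D {i} {j} 1≤i 1≤j j≤p =
    part l i ∸ j , conj l j ∸ i , sym (m∸n+n≡m j≤p) , sym (m∸n+n≡m (part⇒conj D 1≤i 1≤j j≤p)) , refl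

  -- Outside the diagram `part l i < j` and `conj l j < i`, which puts the bead below the hole. A
  -- bead above the hole therefore forces a box, and there the difference is the hook length.
  bead-above-hole : ∀ {l} → Decreasing l → ∀ {i j k} → 1 ≤ i → 1 ≤ j → 1 ≤ k →
    suc (part l i + conj l j) ≡ k + (i + j) → IsBox l i j × hook l i j ≡ k
  bead-above-hole {l} D {i} {j} {k} 1≤i 1≤j 1≤k eq with j ≤? part l i
  ... | yes j≤p with box-split D 1≤i 1≤j j≤p
  ... | u , v , p , c , h =
    (1≤i , part-pos⇒≤-length l i (≤-trans 1≤j j≤p) , 1≤j , j≤p) ,
    trans h (+-cancelʳ-≡ (i + j) _ _ (begin
      suc (u + v) + (i + j)       ≡⟨ rearrange u v i j ⟩
      suc ((u + j) + (v + i))     ≡⟨ cong₂ (λ x y → suc (x + y)) (sym p) (sym c) ⟩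
      suc (part l i + conj l j)   ≡⟨ eq ⟩
      k + (i + j)                 ∎))
    where
    open ≡-Reasoning
    rearrange : ∀ u v i j → suc (u + v) + (i + j) ≡ suc ((u + j) + (v + i))
    rearrange = solve-∀
  bead-above-hole {l} D {i} {j} {k} 1≤i 1≤j 1≤k eq | no j≰p with i ≤? conj l j
  ... | yes i≤c = contradiction (conj⇒part D 1≤i i≤c) j≰p
  ... | no i≰c  = contradiction
    (subst (suc (part l i + conj l j) <_) (+-comm j i)
      (subst (_≤ j + i) (cong suc (+-suc _ _)) (+-mono-≤ (≰⇒> j≰p) (≰⇒> i≰c))))
    (≤⇒≯ (subst (i + j ≤_) (sym eq) (m≤n+m (i + j) k)))

  -- The core condition on Frobenius coordinates

  -- Frobenius coordinates (a_i | a_i + e − 1): e = 1 for self-conjugate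
  -- partitions and e = 0 for doubled distinct ones.
  Shifted : ℕ → List ℕ → Set
  Shifted e l = ∀ j → 1 ≤ j → j ≤ part l j → suc (conj l j) ≡ e + part l j

  DistanceClosed : ℕ → (ℕ → Set) → Set
  DistanceClosed s A = ∀ a → A (a + s) → A a

  -- The diagonal box with arm `b` has leg `e + b - 1`, so `e + (a + b)` is a hook length: that of
  -- the box in the row with arm `a` and the column with this leg.
  SumFree : ℕ → ℕ → (ℕ → Set) → Set
  SumFree e s A = ∀ a b → A a → A b → e + (a + b) ≢ s

  arm-conj : ∀ e l → Shifted e l → ∀ {i a} → 1 ≤ i → part l i ≡ a + i → suc (conj l i) ≡ e + (a + i)
  arm-conj e l sh {i} {a} 1≤i p =
    trans (sh i 1≤i (subst (i ≤_) (sym p) (m≤n+m i a))) (cong (e +_) p)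

  -- Were `a` not an arm, it would be a hole, and the bead `a + s` above it would produce a hook of
  -- length `s`.
  core⇒distanceClosed : ∀ {s l} → 1 ≤ s → Decreasing l → IsCore s l → DistanceClosed s (Arm l)
  core⇒distanceClosed {s} {l} 1≤s D core a (i , 1≤i , p) with arm⊎hole D a
  ... | inj₁ arm = arm
  ... | inj₂ (j , 1≤j , c) with bead-above-hole D {k = s} 1≤i 1≤j 1≤s eq
    where
    rearrange : ∀ a s i c → suc (a + s + i + c) ≡ s + (i + suc (a + c))
    rearrange = solve-∀
    eq : suc (part l i + conj l j) ≡ s + (i + j)
    eq = trans (cong (λ u → suc (u + conj l j)) p)
           (trans (rearrange a s i (conj l j)) (cong (λ u → s + (i + u)) c))
  ... | box , h = ⊥-elim (core i j box (divides 1 (trans h (sym (*-identityˡ s)))))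

  core⇒sumFree : ∀ {e s l} → 1 ≤ s → Decreasing l → Shifted e l → IsCore s l → SumFree e s (Arm l)
  core⇒sumFree {e} {s} {l} 1≤s D sh core a b (i , 1≤i , p) (j , 1≤j , q) sum≡s
    with bead-above-hole D {k = s} 1≤i 1≤j 1≤s eq
    where
    rearrange : ∀ e a b i j → a + i + (e + (b + j)) ≡ e + (a + b) + (i + j)
    rearrange = solve-∀
    eq : suc (part l i + conj l j) ≡ s + (i + j)
    eq = begin
      suc (part l i + conj l j)      ≡⟨ sym (+-suc _ _) ⟩
      part l i + suc (conj l j)      ≡⟨ cong₂ _+_ p (arm-conj e l sh 1≤j q) ⟩
      a + i + (e + (b + j))          ≡⟨ rearrange e a b i j ⟩
      e + (a + b) + (i + j)          ≡⟨ cong (_+ (i + j)) sum≡s ⟩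
      s + (i + j)                    ∎
      where open ≡-Reasoning
  ... | box , h = core i j box (divides 1 (trans h (sym (*-identityˡ s))))

  distanceClosed-* : ∀ {s A} → DistanceClosed s A → ∀ k {a} → A (a + k * s) → A a
  distanceClosed-* {A = A} cl zero    {a} p = subst A (+-identityʳ a) p
  distanceClosed-* {s} {A} cl (suc k) {a} p =
    distanceClosed-* cl k (cl (a + k * s) (subst A (rearrange a s (k * s)) p))
    where
    rearrange : ∀ a s m → a + (s + m) ≡ a + m + s
    rearrange = solve-∀

  -- Subtracting s from an arm ≥ s reduces a sum e + a + b = k s to the case k = 1.
  sumFree-* : ∀ {e s A} → e ≤ 1 → DistanceClosed s A → SumFree e s A →
    ∀ k {a b} → A a → A b → e + (a + b) ≢ suc k * s
  sumFree-* {s = s} e≤1 cl sf zero Aa Ab eq = sf _ _ Aa Ab (trans eq (*-identityˡ s))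
  sumFree-* {e} {s} {A} e≤1 cl sf (suc k) {a} {b} Aa Ab eq with s ≤? a | s ≤? b
  ... | yes s≤a | _ = sumFree-* e≤1 cl sf k (cl (a ∸ s) (subst A (sym a≡) Aa)) Ab
      (+-cancelʳ-≡ s _ _ (begin
        e + (a ∸ s + b) + s   ≡⟨ rearrange e (a ∸ s) b s ⟩
        e + (a ∸ s + s + b)   ≡⟨ cong (λ u → e + (u + b)) a≡ ⟩
        e + (a + b)           ≡⟨ eq ⟩
        suc (suc k) * s       ≡⟨ +-comm s _ ⟩
        suc k * s + s         ∎))
    where
    open ≡-Reasoning
    a≡ : a ∸ s + s ≡ a
    a≡ = m∸n+n≡m s≤a
    rearrange : ∀ e a b s → e + (a + b) + s ≡ e + (a + s + b)
    rearrange = solve-∀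
  ... | no _ | yes s≤b = sumFree-* e≤1 cl sf k Aa (cl (b ∸ s) (subst A (sym b≡) Ab))
      (+-cancelʳ-≡ s _ _ (begin
        e + (a + (b ∸ s)) + s   ≡⟨ rearrange e a (b ∸ s) s ⟩
        e + (a + (b ∸ s + s))   ≡⟨ cong (λ u → e + (a + u)) b≡ ⟩
        e + (a + b)             ≡⟨ eq ⟩
        suc (suc k) * s         ≡⟨ +-comm s _ ⟩
        suc k * s + s           ∎))
    where
    open ≡-Reasoning
    b≡ : b ∸ s + s ≡ b
    b≡ = m∸n+n≡m s≤b
    rearrange : ∀ e a b s → e + (a + b) + s ≡ e + (a + (b + s))
    rearrange = solve-∀
  ... | no s≰a | no s≰b = <-irrefl eq (begin-strict
      e + (a + b)         ≤⟨ +-monoˡ-≤ (a + b) e≤1 ⟩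
      suc a + b           <⟨ +-mono-≤-< (≰⇒> s≰a) (≰⇒> s≰b) ⟩
      s + s               ≤⟨ +-monoʳ-≤ s (m≤m+n s (k * s)) ⟩
      suc (suc k) * s     ∎)
    where open ≤-Reasoning

  -- The cases are the signs of the bead and the hole that span the hook. A nonnegative bead over a
  -- negative hole gives a sum of two arms; equal signs give a distance between arms, after a
  -- reflection by `Shifted` if both are negative.
  core-criterion : ∀ {e s l} → e ≤ 1 → Decreasing l → Shifted e l →
    DistanceClosed s (Arm l) → SumFree e s (Arm l) → IsCore s l
  core-criterion {e} {s} {l} e≤1 D sh cl sf i j (1≤i , _ , 1≤j , j≤p) (divides k h≡ks)
    with box-split D 1≤i 1≤j j≤p
  ... | u , v , p , c , h = go k (trans (sym h) h≡ks) (i ≤? part l i) (j ≤? part l j)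
    where
    open ≡-Reasoning
    go : ∀ k → suc (u + v) ≡ k * s → _ → _ → ⊥
    go zero () _ _
    go (suc k) eq (yes i≤pi) (yes j≤pj) =
      sumFree-* e≤1 cl sf k (i , 1≤i , pi) (j , 1≤j , pj) (+-cancelʳ-≡ (i + j) _ _ (begin
        e + (a + b) + (i + j)         ≡⟨ rearrange₁ e a b i j ⟩
        (a + i) + (e + (b + j))       ≡⟨ cong₂ _+_ (sym pi) (sym (arm-conj e l sh 1≤j pj)) ⟩
        part l i + suc (conj l j)     ≡⟨ cong₂ (λ x y → x + suc y) p c ⟩
        (u + j) + suc (v + i)         ≡⟨ rearrange₂ u v i j ⟩
        suc (u + v) + (i + j)         ≡⟨ cong (_+ (i + j)) eq ⟩
        suc k * s + (i + j)           ∎))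
      where
      a = part l i ∸ i
      b = part l j ∸ j
      pi : part l i ≡ a + i
      pi = sym (m∸n+n≡m i≤pi)
      pj : part l j ≡ b + j
      pj = sym (m∸n+n≡m j≤pj)
      rearrange₁ : ∀ e a b i j → e + (a + b) + (i + j) ≡ (a + i) + (e + (b + j))
      rearrange₁ = solve-∀
      rearrange₂ : ∀ u v i j → (u + j) + suc (v + i) ≡ suc (u + v) + (i + j)
      rearrange₂ = solve-∀
    -- Both are nonnegative: moving the bead down by `k` steps of `s` lands on the hole `b`.
    go k@(suc _) eq (yes i≤pi) (no j≰pj) =
      ¬arm×hole D (distanceClosed-* cl k (i , 1≤i , pi)) (j , 1≤j , hole)
      where
      c<j : conj l j < j
      c<j = ≰⇒> λ j≤c → j≰pj (conj⇒part D 1≤j j≤c)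
      b = j ∸ suc (conj l j)
      hole : suc (b + conj l j) ≡ j
      hole = trans (sym (+-suc b _)) (m∸n+n≡m c<j)
      rearrange : ∀ u v i b → u + suc (b + (v + i)) ≡ b + suc (u + v) + i
      rearrange = solve-∀
      pi : part l i ≡ b + k * s + i
      pi = begin
        part l i                   ≡⟨ p ⟩
        u + j                      ≡⟨ cong (u +_) (sym hole) ⟩
        u + suc (b + conj l j)     ≡⟨ cong (λ x → u + suc (b + x)) c ⟩
        u + suc (b + (v + i))      ≡⟨ rearrange u v i b ⟩
        b + suc (u + v) + i        ≡⟨ cong (λ x → b + x + i) eq ⟩
        b + k * s + i              ∎
    -- Both are negative, with the bead at `-b` and the hole `k * s` below it. Row `j` then has arm
    -- `d + k * s` with `d = b - e`; closure makes `d` an arm, and the column of that arm is a hole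
    -- at `-(e + d) = -b`, where row `i` has its bead.
    go k@(suc _) eq (no i≰pi) (yes j≤pj) = contra (distanceClosed-* cl k (j , 1≤j , pj))
      where
      b = i ∸ part l i
      pb : b + part l i ≡ i
      pb = m∸n+n≡m (≤-trans (n≤1+n _) (≰⇒> i≰pi))
      e≤b : e ≤ b
      e≤b = ≤-trans e≤1 (m<n⇒0<n∸m (≰⇒> i≰pi))
      d = b ∸ e
      d+e : d + e ≡ b
      d+e = m∸n+n≡m e≤b
      rearrange₁ : ∀ v b u j → suc (v + (b + (u + j))) ≡ b + (suc (u + v) + j)
      rearrange₁ = solve-∀
      rearrange₂ : ∀ d e m → d + e + m ≡ e + (d + m)
      rearrange₂ = solve-∀
      pj : part l j ≡ d + k * s + j
      pj = +-cancelˡ-≡ e _ _ (begin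
        e + part l j                    ≡⟨ sym (sh j 1≤j j≤pj) ⟩
        suc (conj l j)                  ≡⟨ cong suc c ⟩
        suc (v + i)                     ≡⟨ cong (λ x → suc (v + x)) (sym pb) ⟩
        suc (v + (b + part l i))        ≡⟨ cong (λ x → suc (v + (b + x))) p ⟩
        suc (v + (b + (u + j)))         ≡⟨ rearrange₁ v b u j ⟩
        b + (suc (u + v) + j)           ≡⟨ cong₂ (λ x y → x + (y + j)) (sym d+e) eq ⟩
        d + e + (k * s + j)             ≡⟨ rearrange₂ d e _ ⟩
        e + (d + (k * s + j))           ≡⟨ cong (e +_) (sym (+-assoc d _ j)) ⟩
        e + (d + k * s + j)             ∎)
      rearrange₃ : ∀ p e d m → p + (e + (d + m)) ≡ d + e + p + m
      rearrange₃ = solve-∀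
      contra : Arm l d → ⊥
      contra (m , 1≤m , pm) = bead≢hole D {i} {m} 1≤i 1≤m (begin
        suc (part l i + conj l m)   ≡⟨ sym (+-suc _ _) ⟩
        part l i + suc (conj l m)   ≡⟨ cong (part l i +_) (arm-conj e l sh 1≤m pm) ⟩
        part l i + (e + (d + m))    ≡⟨ rearrange₃ (part l i) e d m ⟩
        d + e + part l i + m        ≡⟨ cong (λ x → x + part l i + m) d+e ⟩
        b + part l i + m            ≡⟨ cong (_+ m) pb ⟩
        i + m                       ∎)
    -- The row of the box ends before the diagonal, so `j < i`, and so does its column, so `i < j`.
    go (suc _) eq (no i≰pi) (no j≰pj) =
      <-asym (≤-<-trans j≤p (≰⇒> i≰pi))
             (≤-<-trans (part⇒conj D 1≤i 1≤j j≤p) (≰⇒> λ j≤c → j≰pj (conj⇒part D 1≤j j≤c)))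

  -- Partitions are determined by their arms

  -- Let `k` be the row of `m` with the arm of row `i` of `l`. If `k < i`, the partitions agree in
  -- row `k`, which would make row `k` of `l` shorter than row `i`. So `i ≤ k`, and equal arms make
  -- row `k` of `m` at least as long as row `i` of `l`.
  diagonal-≤ : ∀ {l m} → Decreasing l → Decreasing m → Arm l ⊆ Arm m → ∀ {i} → 1 ≤ i →
    (∀ {k} → k < i → 1 ≤ k → k ≤ part m k → part l k ≡ part m k) →
    i ≤ part l i → part l i ≤ part m i
  diagonal-≤ {l} {m} Dl Dm l⊆m {i} 1≤i below i≤p
    with l⊆m (i , 1≤i , sym (m∸n+n≡m i≤p))
  ... | k , 1≤k , q with i ≤? k
  ... | yes i≤k = begin
      part l i            ≡⟨ sym (m∸n+n≡m i≤p) ⟩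
      part l i ∸ i + i    ≤⟨ +-monoʳ-≤ (part l i ∸ i) i≤k ⟩
      part l i ∸ i + k    ≡⟨ sym q ⟩
      part m k            ≤⟨ part-antitone Dm 1≤i i≤k ⟩
      part m i            ∎
    where open ≤-Reasoning
  ... | no i≰k = contradiction (begin-strict
      part l k            ≡⟨ below (≰⇒> i≰k) 1≤k (subst (k ≤_) (sym q) (m≤n+m k _)) ⟩
      part m k            ≡⟨ q ⟩
      part l i ∸ i + k    <⟨ +-monoʳ-< (part l i ∸ i) (≰⇒> i≰k) ⟩
      part l i ∸ i + i    ≡⟨ m∸n+n≡m i≤p ⟩
      part l i            ≤⟨ part-antitone Dl 1≤k (<⇒≤ (≰⇒> i≰k)) ⟩
      part l k            ∎) (<-irrefl refl)
    where open ≤-Reasoning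

  diagonal-≡ : ∀ {l m} → Decreasing l → Decreasing m → Arm l ⊆ Arm m → Arm m ⊆ Arm l →
    ∀ i → 1 ≤ i → i ≤ part l i ⊎ i ≤ part m i → part l i ≡ part m i
  diagonal-≡ {l} {m} Dl Dm l⊆m m⊆l = <-rec _ step
    where
    step : ∀ i → (∀ {k} → k < i → 1 ≤ k → k ≤ part l k ⊎ k ≤ part m k → part l k ≡ part m k) →
      1 ≤ i → i ≤ part l i ⊎ i ≤ part m i → part l i ≡ part m i
    step i rec 1≤i = [ left , (λ i≤m → left (≤-trans i≤m (ge i≤m))) ]′
      where
      le : i ≤ part l i → part l i ≤ part m i
      le = diagonal-≤ Dl Dm l⊆m 1≤i λ k<i 1≤k k≤m → rec k<i 1≤k (inj₂ k≤m)
      ge : i ≤ part m i → part m i ≤ part l i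
      ge = diagonal-≤ Dm Dl m⊆l 1≤i λ k<i 1≤k k≤l → sym (rec k<i 1≤k (inj₁ k≤l))
      left : i ≤ part l i → part l i ≡ part m i
      left i≤l = ≤-antisym (le i≤l) (ge (≤-trans i≤l (le i≤l)))

  part⇒conj-diagonal : ∀ {l} → Decreasing l → ∀ {j k} → 1 ≤ k → k < j → k ≤ part l j →
    k ≤ part l k × j ≤ conj l k
  part⇒conj-diagonal D {j} {k} 1≤k k<j k≤pj = conj⇒part D 1≤k (≤-trans (<⇒≤ k<j) j≤ck) , j≤ck
    where
    j≤ck = part⇒conj D (≤-trans 1≤k (<⇒≤ k<j)) 1≤k k≤pj

  -- Rows that reach the diagonal are settled by `diagonal-≡`. The boxes of any other row lie in
  -- columns that do reach it, and `Shifted` computes the length of such a column from the row of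
  -- the same index.
  arms-determine : ∀ {e l m} → IsPartition l → IsPartition m → Shifted e l → Shifted e m →
    Arm l ⊆ Arm m → Arm m ⊆ Arm l → l ≡ m
  arms-determine {e} {l} {m} (Dl , pl) (Dm , pm) sl sm l⊆m m⊆l = part-ext pl pm eq
    where
    diag : ∀ i → 1 ≤ i → i ≤ part l i ⊎ i ≤ part m i → part l i ≡ part m i
    diag = diagonal-≡ Dl Dm l⊆m m⊆l
    off : ∀ {l m} → Decreasing l → Decreasing m → Shifted e l → Shifted e m →
      (∀ i → 1 ≤ i → i ≤ part l i → part l i ≡ part m i) →
      ∀ {j} → 1 ≤ j → ¬ (j ≤ part l j) → ∀ k → 1 ≤ k → k ≤ part l j → k ≤ part m j
    off {l} {m} Dl Dm sl sm diag {j} 1≤j j≰ k 1≤k k≤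
      with part⇒conj-diagonal Dl 1≤k (≤-<-trans k≤ (≰⇒> j≰)) k≤
    ... | k≤lk , j≤ck = conj⇒part Dm 1≤j (subst (j ≤_) conj≡ j≤ck)
      where
      open ≡-Reasoning
      part≡ = diag k 1≤k k≤lk
      conj≡ : conj l k ≡ conj m k
      conj≡ = suc-injective (begin
        suc (conj l k)   ≡⟨ sl k 1≤k k≤lk ⟩
        e + part l k     ≡⟨ cong (e +_) part≡ ⟩
        e + part m k     ≡⟨ sym (sm k 1≤k (subst (k ≤_) part≡ k≤lk)) ⟩
        suc (conj m k)   ∎)
    eq : ∀ i → 1 ≤ i → part l i ≡ part m i
    eq i 1≤i with i ≤? part l i | i ≤? part m i
    ... | yes p | _     = diag i 1≤i (inj₁ p)
    ... | no _  | yes q = diag i 1≤i (inj₂ q)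
    ... | no ¬p | no ¬q = ≤-extensional
      (off Dl Dm sl sm (λ k 1≤k k≤ → diag k 1≤k (inj₁ k≤)) 1≤i ¬p)
      (off Dm Dl sm sl (λ k 1≤k k≤ → sym (diag k 1≤k (inj₂ k≤))) 1≤i ¬q)

  -- Self-conjugate and doubled distinct partitions as shifted partitions

  selfConj⇒shifted : ∀ {l} → IsSelfConj l → Shifted 1 l
  selfConj⇒shifted sc j 1≤j _ = cong suc (sym (sc j 1≤j))

  -- `Shifted` covers only diagonal indices. For any other `j`, the boxes of row `j` and of column
  -- `j` lie in columns and rows of smaller index that reach the diagonal, where it applies.
  shifted⇒selfConj : ∀ {l} → Decreasing l → Shifted 1 l → IsSelfConj l
  shifted⇒selfConj {l} D sh j 1≤j with j ≤? part l j
  ... | yes j≤p = sym (suc-injective (sh j 1≤j j≤p))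
  ... | no j≰p  = ≤-extensional to from
    where
    to : ∀ k → 1 ≤ k → k ≤ part l j → k ≤ conj l j
    to k 1≤k k≤ with part⇒conj-diagonal D 1≤k (≤-<-trans k≤ (≰⇒> j≰p)) k≤
    ... | k≤pk , j≤ck = part⇒conj D 1≤k 1≤j (subst (j ≤_) (suc-injective (sh k 1≤k k≤pk)) j≤ck)
    from : ∀ k → 1 ≤ k → k ≤ conj l j → k ≤ part l j
    from k 1≤k k≤ = conj⇒part D 1≤j (subst (j ≤_) (sym (suc-injective (sh k 1≤k k≤pk))) j≤pk)
      where
      j≤pk : j ≤ part l k
      j≤pk = conj⇒part D 1≤k k≤
      k<j : k < j
      k<j = ≤-<-trans k≤ (≰⇒> λ j≤c → j≰p (conj⇒part D 1≤j j≤c))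
      k≤pk : k ≤ part l k
      k≤pk = ≤-trans (<⇒≤ k<j) j≤pk

  module _ {P : ℕ → Set} (P? : Decidable P) where

    descend : ∀ (f : ℕ → ℕ) → (∀ k → P (f (suc k)) → P (f k)) → ∀ k → P (f k) → P (f 0)
    descend f down zero    p = p
    descend f down (suc k) p = descend f down k (down k p)

    -- A predicate that descends along `f` holds on an initial segment, so the length of the
    -- filtered list says where it ends. For diagonal rows this length is the `d` of
    -- `IsDoubledDistinct`.
    filter-prefix⁻ : ∀ f n → (∀ k → P (f (suc k)) → P (f k)) →
      ∀ k → k < length (filter P? (applyUpTo f n)) → P (f k)
    filter-prefix⁻ f (suc n) down k k< with P? (f 0)
    ... | no ¬p0 = contradiction
      (descend f down (suc k) (filter-prefix⁻ (f ∘ suc) n (down ∘ suc) k k<)) ¬p0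
    filter-prefix⁻ f (suc n) down zero    k<       | yes p0 = p0
    filter-prefix⁻ f (suc n) down (suc k) (s≤s k<) | yes p0 = filter-prefix⁻ (f ∘ suc) n (down ∘ suc) k k<

    filter-prefix⁺ : ∀ f n → (∀ k → P (f (suc k)) → P (f k)) →
      ∀ k → k < n → P (f k) → k < length (filter P? (applyUpTo f n))
    filter-prefix⁺ f (suc n) down k k<n p with P? (f 0)
    filter-prefix⁺ f (suc n) down k k<n p | no ¬p0 = contradiction (descend f down k p) ¬p0
    filter-prefix⁺ f (suc n) down zero    _         p | yes _ = s≤s z≤n
    filter-prefix⁺ f (suc n) down (suc k) (s≤s k<n) p | yes _ = s≤s (filter-prefix⁺ (f ∘ suc) n (down ∘ suc) k k<n p)

  module _ {l : List ℕ} (D : Decreasing l) where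

    private
      diagonal-down : ∀ k → suc (suc k) ≤ part l (suc (suc k)) → suc k ≤ part l (suc k)
      diagonal-down k le = ≤-trans (n≤1+n _) (≤-trans le (part-antitone D (s≤s z≤n) (n≤1+n _)))

    diagIdx-length⁻ : ∀ k → k < length (diagIdx l) → suc k ≤ part l (suc k)
    diagIdx-length⁻ = filter-prefix⁻ (λ i → i ≤? part l i) suc (length l) diagonal-down

    diagIdx-length⁺ : ∀ k → suc k ≤ part l (suc k) → k < length (diagIdx l)
    diagIdx-length⁺ k le = filter-prefix⁺ (λ i → i ≤? part l i) suc (length l) diagonal-down k
      (part-pos⇒≤-length l (suc k) (≤-trans (s≤s z≤n) le)) le

  [m+n]-n≡m : ∀ m n → pos (m + n) ℤ- pos n ≡ pos m
  [m+n]-n≡m m n = trans (ℤP.m-n≡m⊖n (m + n) n)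
    (trans (ℤP.⊖-≥ (m≤n+m n m)) (cong pos (m+n∸n≡m m n)))

  m-n≡k⇒m≡k+n : ∀ {m n k} → pos m ℤ- pos n ≡ pos k → m ≡ k + n
  m-n≡k⇒m≡k+n {m} {n} {k} eq = ℤP.+-injective (begin
    pos m                        ≡⟨ rearrange (pos m) (pos n) ⟩
    (pos m ℤ- pos n) ℤ+ pos n    ≡⟨ cong (_ℤ+ pos n) eq ⟩
    pos (k + n)                  ∎)
    where
    open ≡-Reasoning
    rearrange : ∀ x y → x ≡ (x ℤ- y) ℤ+ y
    rearrange = solve-ℤ

  doubledDistinct⇒shifted : ∀ {l} → Decreasing l → IsDoubledDistinct l → Shifted 0 l
  doubledDistinct⇒shifted D (inj₁ refl) j 1≤j j≤0 = contradiction (≤-trans 1≤j j≤0) λ ()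
  doubledDistinct⇒shifted {l} D (inj₂ (_ , a , _ , a≥1 , refl , eqs)) (suc k) _ j≤p =
    subst (λ i → suc (conj l (suc i)) ≡ part l (suc i)) (toℕ-fromℕ< k<d) (shifted (a p) (a≥1 p) (eqs p))
    where
    k<d : k < length (diagIdx l)
    k<d = diagIdx-length⁺ D k j≤p
    p = fromℕ< k<d
    shifted : ∀ {j} x → 1 ≤ x →
      pos (part l j) ℤ- pos j ≡ pos x × pos (conj l j) ℤ- pos j ≡ pos x ℤ- pos 1 →
      suc (conj l j) ≡ part l j
    shifted {j} (suc x) _ (pj , cj) =
      trans (cong suc (m-n≡k⇒m≡k+n {n = j} {k = x} cj)) (sym (m-n≡k⇒m≡k+n {n = j} pj))

  shifted⇒doubledDistinct : ∀ {l} → Decreasing l → Shifted 0 l → IsDoubledDistinct l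
  shifted⇒doubledDistinct {l} D sh = inj₂
    (length (diagIdx l) , a , decreasing , (λ p → proj₁ (facts p)) , refl , λ p → proj₂ (facts p))
    where
    a : Fin (length (diagIdx l)) → ℕ
    a p = part l (suc (toℕ p)) ∸ suc (toℕ p)
    diag : ∀ p → suc (toℕ p) ≤ part l (suc (toℕ p))
    diag p = diagIdx-length⁻ D (toℕ p) (toℕ<n p)
    decreasing : ∀ p q → toℕ p < toℕ q → a q < a p
    decreasing p q p<q = +-cancelʳ-< (suc (toℕ p)) (a q) (a p) (begin-strict
      a q + suc (toℕ p)    <⟨ +-monoʳ-< (a q) (s≤s p<q) ⟩
      a q + suc (toℕ q)    ≡⟨ m∸n+n≡m (diag q) ⟩
      part l (suc (toℕ q)) ≤⟨ part-antitone D (s≤s z≤n) (s≤s (<⇒≤ p<q)) ⟩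
      part l (suc (toℕ p)) ≡⟨ sym (m∸n+n≡m (diag p)) ⟩
      a p + suc (toℕ p)    ∎)
      where open ≤-Reasoning
    Facts : ℕ → ℕ → Set
    Facts j x = 1 ≤ x × (pos (part l j) ℤ- pos j ≡ pos x × pos (conj l j) ℤ- pos j ≡ pos x ℤ- pos 1)
    facts : ∀ p → Facts (suc (toℕ p)) (a p)
    facts p with box-split D {suc (toℕ p)} {suc (toℕ p)} (s≤s z≤n) (s≤s z≤n) (diag p)
    ... | u , v , pu , cv , _ = subst (Facts j) (sym a≡)
        (s≤s z≤n ,
         trans (cong (λ z → pos z ℤ- pos j) (trans pu (cong (_+ j) u≡))) ([m+n]-n≡m (suc v) j) ,
         trans (cong (λ z → pos z ℤ- pos j) cv) ([m+n]-n≡m v j))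
      where
      j = suc (toℕ p)
      u≡ : u ≡ suc v
      u≡ = +-cancelʳ-≡ j u (suc v) (trans (sym pu) (trans (sym (sh j (s≤s z≤n) (diag p))) (cong suc cv)))
      a≡ : a p ≡ suc v
      a≡ = trans (cong (_∸ j) pu) (trans (m+n∸n≡m u j) u≡)

  -- With `e = 0`, the arm `0` would come with the leg `-1`. This is what keeps `0` out of Δ.
  ¬arm-0 : ∀ {l} → Decreasing l → Shifted 0 l → ¬ Arm l 0
  ¬arm-0 D sh (i , 1≤i , p) =
    <-irrefl refl (≤-trans (s≤s (part⇒conj D 1≤i 1≤i (≤-reflexive (sym p))))
      (≤-reflexive (trans (sh i 1≤i (≤-reflexive (sym p))) p)))

  principalHook : ∀ {e l} → Decreasing l → Shifted e l → ∀ {i a} → 1 ≤ i → part l i ≡ a + i →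
    hook l i i ≡ e + (a + a)
  principalHook {e} {l} D sh {i} {a} 1≤i p
    with box-split D 1≤i 1≤i (subst (i ≤_) (sym p) (m≤n+m i a))
  ... | u , v , pu , cv , h = begin
      hook l i i      ≡⟨ h ⟩
      suc (u + v)     ≡⟨ sym (+-suc u v) ⟩
      u + suc v       ≡⟨ cong₂ _+_ u≡a v≡ ⟩
      a + (e + a)     ≡⟨ rearrange a e ⟩
      e + (a + a)     ∎
    where
    open ≡-Reasoning
    u≡a : u ≡ a
    u≡a = +-cancelʳ-≡ i u a (trans (sym pu) p)
    v≡ : suc v ≡ e + a
    v≡ = +-cancelʳ-≡ i (suc v) (e + a) (trans (cong suc (sym cv))
      (trans (arm-conj e l sh 1≤i p) (sym (+-assoc e a i))))
    rearrange : ∀ a e → a + (e + a) ≡ e + (a + a)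
    rearrange = solve-∀

  ∈-principalHooks⁺ : ∀ {e l} → Decreasing l → Shifted e l → ∀ {a} → Arm l a →
    e + (a + a) ∈ principalHooks l
  ∈-principalHooks⁺ {e} {l} D sh {a} (suc k , 1≤i , p) =
    ∈-map∘filter⁺ (λ i → hook l i i) (λ i → i ≤? part l i)
      (suc k , ∈-applyUpTo⁺ suc (part-pos⇒≤-length l (suc k) (≤-trans (s≤s z≤n) i≤p)) ,
       sym (principalHook D sh 1≤i p) , i≤p)
    where
    i≤p : suc k ≤ part l (suc k)
    i≤p = subst (suc k ≤_) (sym p) (m≤n+m (suc k) a)

  ∈-principalHooks⁻ : ∀ {e l} → Decreasing l → Shifted e l → ∀ {h} → h ∈ principalHooks l →
    ∃ λ a → Arm l a × h ≡ e + (a + a)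
  ∈-principalHooks⁻ {l = l} D sh h∈ with ∈-map∘filter⁻ (λ i → hook l i i) (λ i → i ≤? part l i) {xs = applyUpTo suc (length l)} h∈
  ... | i , i∈ , h≡ , i≤p with ∈-applyUpTo⁻ suc i∈
  ... | _ , _ , refl = _ , (i , s≤s z≤n , p) , trans h≡ (principalHook D sh (s≤s z≤n) p)
    where
    p : part l i ≡ part l i ∸ i + i
    p = sym (m∸n+n≡m i≤p)

  -- Partitions with prescribed Frobenius coordinates

  -- A new first column of length n, for a partition with at most n rows.
  pad : ℕ → List ℕ → List ℕ
  pad zero    _        = []
  pad (suc n) []       = 1 ∷ pad n []
  pad (suc n) (x ∷ xs) = suc x ∷ pad n xs

  length-pad : ∀ n xs → length (pad n xs) ≡ n
  length-pad zero    _        = refl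
  length-pad (suc n) []       = cong suc (length-pad n [])
  length-pad (suc n) (x ∷ xs) = cong suc (length-pad n xs)

  part-pad-≤ : ∀ {n} xs {i} → 1 ≤ i → i ≤ n → part (pad n xs) i ≡ suc (part xs i)
  part-pad-≤ []       {suc zero}    _ (s≤s _)  = refl
  part-pad-≤ []       {suc (suc i)} _ (s≤s le) = part-pad-≤ [] (s≤s z≤n) le
  part-pad-≤ (x ∷ xs) {suc zero}    _ (s≤s _)  = refl
  part-pad-≤ (x ∷ xs) {suc (suc i)} _ (s≤s le) = part-pad-≤ xs (s≤s z≤n) le

  part-pad-pos : ∀ n xs {i} → 1 ≤ part (pad n xs) i → i ≤ n
  part-pad-pos n xs {i} p = subst (i ≤_) (length-pad n xs) (part-pos⇒≤-length (pad n xs) i p)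

  sum-pad : ∀ n xs → length xs ≤ n → sum (pad n xs) ≡ n + sum xs
  sum-pad zero    []       _        = refl
  sum-pad (suc n) []       _        = cong suc (sum-pad n [] z≤n)
  sum-pad (suc n) (x ∷ xs) (s≤s le) = cong suc (trans (cong (λ s → x + s) (sum-pad n xs le)) (rearrange x n (sum xs)))
    where
    rearrange : ∀ x n s → x + (n + s) ≡ n + (x + s)
    rearrange = solve-∀

  pad-positive : ∀ n xs → All (0 <_) (pad n xs)
  pad-positive zero    _        = []
  pad-positive (suc n) []       = s≤s z≤n ∷ pad-positive n []
  pad-positive (suc n) (x ∷ xs) = s≤s z≤n ∷ pad-positive n xs

  ∷-decreasing : ∀ {x xs} → part xs 1 ≤ x → Decreasing xs → Decreasing (x ∷ xs)
  ∷-decreasing {xs = []}    _ _ = [-]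
  ∷-decreasing {xs = _ ∷ _} h D = h ∷ D

  part-pad-1 : ∀ n xs → part (pad n xs) 1 ≤ suc (part xs 1)
  part-pad-1 zero    _        = z≤n
  part-pad-1 (suc n) []       = ≤-refl
  part-pad-1 (suc n) (x ∷ xs) = ≤-refl

  pad-decreasing : ∀ n {xs} → Decreasing xs → Decreasing (pad n xs)
  pad-decreasing zero             _ = []
  pad-decreasing (suc n) {[]}     D = ∷-decreasing (part-pad-1 n []) (pad-decreasing n D)
  pad-decreasing (suc n) {x ∷ xs} D =
    ∷-decreasing (≤-trans (part-pad-1 n xs) (s≤s (part-≤-head D 1))) (pad-decreasing n (Linked.tail D))

  -- The partition with Frobenius coordinates (a | e + a − 1) for a in the list.
  build : ℕ → List ℕ → List ℕ
  build e []       = []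
  build e (a ∷ as) = suc a ∷ pad (pred (e + a)) (build e as)

  module _ (e : ℕ) where

    -- Ensures that `pad` cuts off no row: an inner partition with largest arm `b` has `e + b` rows,
    -- and `b < a`.
    build-length : ∀ {a as} → Linked _>_ (a ∷ as) → All (λ x → 0 < e + x) (a ∷ as) →
      length (build e as) ≤ pred (e + a)
    build-length [-]               _             = z≤n
    build-length {a} {b ∷ as} (b<a ∷ _) (_ ∷ pb ∷ _) = begin
      suc (length (pad (pred (e + b)) (build e as)))   ≡⟨ cong suc (length-pad _ (build e as)) ⟩
      suc (pred (e + b))                               ≡⟨ suc-pred (e + b) {{>-nonZero pb}} ⟩
      e + b                                            ≤⟨ <⇒≤pred (+-monoʳ-< e b<a) ⟩
      pred (e + a)                                     ∎
      where open ≤-Reasoning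

    build-part-1 : ∀ {a as} → Linked _>_ (a ∷ as) → part (build e as) 1 ≤ a
    build-part-1 [-]       = z≤n
    build-part-1 (b<a ∷ _) = b<a

    build-isPartition : ∀ {as} → Linked _>_ as → IsPartition (build e as)
    build-isPartition {[]}     _  = [] , []
    build-isPartition {a ∷ as} as> =
      ∷-decreasing (≤-trans (part-pad-1 (pred (e + a)) (build e as)) (s≤s (build-part-1 as>)))
        (pad-decreasing _ (proj₁ (build-isPartition (Linked.tail as>)))) ,
      s≤s z≤n ∷ pad-positive (pred (e + a)) (build e as)

    part-build-suc⁻ : ∀ {a as i x} → 1 ≤ i → suc x ≤ part (build e (a ∷ as)) (suc i) →
      i ≤ pred (e + a) × x ≤ part (build e as) i
    part-build-suc⁻ {a} {as} {suc i} {x} 1≤i le = i≤n , s≤s⁻¹ (subst (suc x ≤_) (part-pad-≤ (build e as) 1≤i i≤n) le)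
      where
      i≤n : suc i ≤ pred (e + a)
      i≤n = part-pad-pos (pred (e + a)) (build e as) (≤-trans (s≤s z≤n) le)

    part-build-suc : ∀ {a as i} → Linked _>_ (a ∷ as) → All (λ x → 0 < e + x) (a ∷ as) → 1 ≤ i →
      1 ≤ part (build e as) i → part (build e (a ∷ as)) (suc i) ≡ suc (part (build e as) i)
    part-build-suc {as = as} {i = suc i} as> as>0 1≤i 1≤p = part-pad-≤ (build e as) 1≤i
      (≤-trans (part-pos⇒≤-length (build e as) (suc i) 1≤p) (build-length as> as>0))

    -- The outermost hook satisfies the equation by the choice of its leg. Wrapping it around the
    -- inner partition lengthens each inner diagonal row and column by one, which preserves their
    -- equations.
    build-shifted : ∀ {as} → Linked _>_ as → All (λ x → 0 < e + x) as → Shifted e (build e as)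
    build-shifted {[]} _ _ j 1≤j j≤0 = contradiction (≤-trans 1≤j j≤0) λ ()
    build-shifted {a ∷ as} as> as>0@(pa ∷ _) (suc zero) 1≤j j≤p = begin
      suc (conj l 1)                ≡⟨ cong suc (conj-unique Dl ≤-refl (λ _ → ≤-length⇒part-pos posl)
                                         λ i _ → part-pos⇒≤-length l i) ⟩
      suc (length l)                ≡⟨ cong (λ n → suc (suc n)) (length-pad _ (build e as)) ⟩
      suc (suc (pred (e + a)))      ≡⟨ cong suc (suc-pred (e + a) {{>-nonZero pa}}) ⟩
      suc (e + a)                   ≡⟨ sym (+-suc e a) ⟩
      e + suc a                     ∎
      where
      open ≡-Reasoning
      l = build e (a ∷ as)
      Dl = proj₁ (build-isPartition as>)
      posl = proj₂ (build-isPartition as>)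
    build-shifted {a ∷ as} as> as>0 (suc (suc j)) 1≤j j≤p = begin
      suc (conj l (suc j′))         ≡⟨ cong suc (conj-unique Dl (s≤s z≤n) to from) ⟩
      suc (suc (conj μ j′))
        ≡⟨ cong suc (build-shifted (Linked.tail as>) (All.tail as>0) j′ (s≤s z≤n) j≤μ) ⟩
      suc (e + part μ j′)           ≡⟨ sym (+-suc e _) ⟩
      e + suc (part μ j′)
        ≡⟨ cong (e +_) (sym (part-build-suc as> as>0 (s≤s z≤n) (≤-trans (s≤s z≤n) j≤μ))) ⟩
      e + part l (suc j′)           ∎
      where
      open ≡-Reasoning
      j′ = suc j
      l = build e (a ∷ as)
      μ = build e as
      Dl = proj₁ (build-isPartition as>)
      Dμ = proj₁ (build-isPartition (Linked.tail as>))
      j≤μ : j′ ≤ part μ j′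
      j≤μ = proj₂ (part-build-suc⁻ {as = as} (s≤s z≤n) j≤p)
      to : ∀ i → 1 ≤ i → i ≤ suc (conj μ j′) → suc j′ ≤ part l i
      to (suc zero)    _ _ = s≤s (≤-trans j≤μ (≤-trans (part-antitone Dμ ≤-refl (s≤s z≤n)) (build-part-1 as>)))
      to (suc (suc i)) _ (s≤s i≤c) =
        subst (suc j′ ≤_) (sym (part-build-suc as> as>0 (s≤s z≤n) (≤-trans (s≤s z≤n) j≤μi))) (s≤s j≤μi)
        where
        j≤μi : j′ ≤ part μ (suc i)
        j≤μi = conj⇒part Dμ (s≤s z≤n) i≤c
      from : ∀ i → 1 ≤ i → suc j′ ≤ part l i → i ≤ suc (conj μ j′)
      from (suc zero)    _ _  = s≤s z≤n
      from (suc (suc i)) _ le =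
        s≤s (part⇒conj Dμ (s≤s z≤n) (s≤s z≤n) (proj₂ (part-build-suc⁻ {as = as} (s≤s z≤n) le)))

    build-arm⁺ : ∀ {as x} → Linked _>_ as → All (λ x → 0 < e + x) as → x ∈ as → Arm (build e as) x
    build-arm⁺ {as = a ∷ as} as> as>0 (here refl) = 1 , ≤-refl , +-comm 1 a
    build-arm⁺ {x = x} as> as>0 (there x∈)
      with build-arm⁺ (Linked.tail as>) (All.tail as>0) x∈
    ... | i , 1≤i , p = suc i , s≤s z≤n ,
      trans (part-build-suc as> as>0 1≤i (≤-trans 1≤i (subst (i ≤_) (sym p) (m≤n+m i x))))
        (trans (cong suc p) (sym (+-suc x i)))

    build-arm⁻ : ∀ {as x} → Linked _>_ as → All (λ x → 0 < e + x) as → Arm (build e as) x → x ∈ as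
    build-arm⁻ {[]} {x} _ _ (i , 1≤i , p) =
      contradiction (≤-trans 1≤i (subst (i ≤_) (sym p) (m≤n+m i x))) λ ()
    build-arm⁻ {a ∷ as} {x} _ _ (suc zero , _ , p) = here (suc-injective (trans (+-comm 1 x) (sym p)))
    build-arm⁻ {a ∷ as} {x} as> as>0 (suc (suc i) , _ , p) =
      there (build-arm⁻ (Linked.tail as>) (All.tail as>0)
        (suc i , s≤s z≤n , suc-injective (trans (sym (part-build-suc as> as>0 (s≤s z≤n) 1≤μ)) (trans p (+-suc x _)))))
      where
      1≤μ : 1 ≤ part (build e as) (suc i)
      1≤μ = ≤-trans (s≤s z≤n) (proj₂ (part-build-suc⁻ {as = as} (s≤s z≤n) (subst (suc (suc i) ≤_) (sym p) (m≤n+m _ x))))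

    build-weight : ∀ {as} → Linked _>_ as → All (λ x → 0 < e + x) as →
      weight (build e as) ≡ sum (map (λ a → e + (a + a)) as)
    build-weight {[]} _ _ = refl
    build-weight {a ∷ as} as> as>0@(pa ∷ _) = begin
      suc a + sum (pad (pred (e + a)) μ)       ≡⟨ cong (suc a +_) (sum-pad _ μ (build-length as> as>0)) ⟩
      suc a + (pred (e + a) + weight μ)        ≡⟨ rearrange₁ a (pred (e + a)) (weight μ) ⟩
      a + suc (pred (e + a)) + weight μ
        ≡⟨ cong₂ (λ x y → a + x + y) (suc-pred (e + a) {{>-nonZero pa}})
                                                    (build-weight (Linked.tail as>) (All.tail as>0)) ⟩
      a + (e + a) + s                          ≡⟨ rearrange₂ a e s ⟩
      e + (a + a) + s                          ∎
      where
      open ≡-Reasoning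
      μ = build e as
      s = sum (map (λ a → e + (a + a)) as)
      rearrange₁ : ∀ a p w → suc a + (p + w) ≡ a + suc p + w
      rearrange₁ = solve-∀
      rearrange₂ : ∀ a e s → a + (e + a) + s ≡ e + (a + a) + s
      rearrange₂ = solve-∀

  -- Charge vectors

  -- The length of the initial run of `P`, truncated at `fuel`; `height⁺` therefore requires `P` to
  -- fail at `fuel`.
  height : {P : ℕ → Set} → Decidable P → ℕ → ℕ
  height P? zero = 0
  height P? (suc fuel) with P? 0
  ... | yes _ = suc (height (P? ∘ suc) fuel)
  ... | no _  = 0

  height⁻ : {P : ℕ → Set} (P? : Decidable P) → ∀ fuel {q} → q < height P? fuel → P q
  height⁻ P? (suc fuel) {q} q<h with P? 0
  height⁻ P? (suc fuel) {zero}  _         | yes p0 = p0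
  height⁻ P? (suc fuel) {suc q} (s≤s q<h) | yes _  = height⁻ (P? ∘ suc) fuel q<h

  height⁺ : {P : ℕ → Set} (P? : Decidable P) → (∀ q → P (suc q) → P q) →
    ∀ fuel → ¬ P fuel → ∀ {q} → P q → q < height P? fuel
  height⁺ P? down zero       ¬p {q} p = contradiction (descend P? id down q p) ¬p
  height⁺ P? down (suc fuel) ¬p {q} p with P? 0
  ... | no ¬p0 = contradiction (descend P? id down q p) ¬p0
  height⁺ P? down (suc fuel) ¬p {zero}  p | yes _ = s≤s z≤n
  height⁺ P? down (suc fuel) ¬p {suc q} p | yes _ = s≤s (height⁺ (P? ∘ suc) (down ∘ suc) fuel ¬p p)

  infix 10 _⁺ _⁻
  _⁺ _⁻ : ℤ → ℕ
  pos n ⁺    = n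
  -[1+ n ] ⁺ = 0
  pos n ⁻    = 0
  -[1+ n ] ⁻ = suc n

  ⁺⊖⁻ : ∀ z → z ⁺ ⊖ z ⁻ ≡ z
  ⁺⊖⁻ (pos n)  = ℤP.⊖-≥ z≤n
  ⁺⊖⁻ -[1+ n ] = refl

  ⊖-⁺ : ∀ {m n} → m ≡ 0 ⊎ n ≡ 0 → (m ⊖ n) ⁺ ≡ m
  ⊖-⁺ {n = zero}  (inj₁ refl) = refl
  ⊖-⁺ {n = suc n} (inj₁ refl) = refl
  ⊖-⁺ {m}         (inj₂ refl) = cong _⁺ (ℤP.⊖-≥ {m} z≤n)

  ⊖-⁻ : ∀ {m n} → m ≡ 0 ⊎ n ≡ 0 → (m ⊖ n) ⁻ ≡ n
  ⊖-⁻ {n = zero}  (inj₁ refl) = refl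
  ⊖-⁻ {n = suc n} (inj₁ refl) = refl
  ⊖-⁻ {m}         (inj₂ refl) = cong _⁻ (ℤP.⊖-≥ {m} z≤n)

  ⁺≤∣∣ : ∀ z → z ⁺ ≤ ∣ z ∣
  ⁺≤∣∣ (pos n)  = ≤-refl
  ⁺≤∣∣ -[1+ n ] = z≤n

  ⁻≤∣∣ : ∀ z → z ⁻ ≤ ∣ z ∣
  ⁻≤∣∣ (pos n)  = z≤n
  ⁻≤∣∣ -[1+ n ] = ≤-refl

  -- 1-indexed, 0 outside {1, …, t}.
  at : ∀ {t} → Vec ℤ t → ℕ → ℤ
  at []       _             = pos 0
  at (z ∷ zs) zero          = pos 0
  at (z ∷ zs) (suc zero)    = z
  at (z ∷ zs) (suc (suc i)) = at zs (suc i)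

  at-0 : ∀ {t} (v : Vec ℤ t) → at v 0 ≡ pos 0
  at-0 []      = refl
  at-0 (_ ∷ _) = refl

  at-outside : ∀ {t} (v : Vec ℤ t) → at v (suc t) ≡ pos 0
  at-outside []       = refl
  at-outside (_ ∷ zs) = at-outside zs

  at-lookup : ∀ {t} (v : Vec ℤ t) p → at v (suc (toℕ p)) ≡ lookup v p
  at-lookup (z ∷ zs) Fin.zero    = refl
  at-lookup (z ∷ zs) (Fin.suc p) = at-lookup zs p

  at-tabulate : ∀ {t} (f : ℕ → ℤ) {i} → i < t → at (tabulate {n = t} (f ∘ toℕ)) (suc i) ≡ f i
  at-tabulate {suc t} f {zero}  _         = refl
  at-tabulate {suc t} f {suc i} (s≤s i<t) = at-tabulate (f ∘ suc) i<t

  at-injective : ∀ {t} {v w : Vec ℤ t} → (∀ i → i < t → at v (suc i) ≡ at w (suc i)) → v ≡ w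
  at-injective {v = v} {w} eq = begin
    v                      ≡⟨ sym (tabulate∘lookup v) ⟩
    tabulate (lookup v)
      ≡⟨ tabulate-cong (λ p → trans (sym (at-lookup v p)) (trans (eq (toℕ p) (toℕ<n p)) (at-lookup w p))) ⟩
    tabulate (lookup w)    ≡⟨ tabulate∘lookup w ⟩
    w                      ∎
    where open ≡-Reasoning

  size : ∀ {t} → Vec ℤ t → ℕ
  size []       = 0
  size (z ∷ zs) = ∣ z ∣ + size zs

  ∣at∣≤size : ∀ {t} (v : Vec ℤ t) i → ∣ at v i ∣ ≤ size v
  ∣at∣≤size []       i             = z≤n
  ∣at∣≤size (z ∷ zs) zero          = z≤n
  ∣at∣≤size (z ∷ zs) (suc zero)    = m≤m+n _ _
  ∣at∣≤size (z ∷ zs) (suc (suc i)) = ≤-trans (∣at∣≤size zs (suc i)) (m≤n+m _ _)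

  <-extensional : ∀ {m n} → (∀ {q} → q < m → q < n) → (∀ {q} → q < n → q < m) → m ≡ n
  <-extensional f g = ≤-extensional (λ { (suc i) _ → f }) (λ { (suc i) _ → g })

  ¬positive⇒≡0 : ∀ {n} → ¬ (0 < n) → n ≡ 0
  ¬positive⇒≡0 ¬p = n≤0⇒n≡0 (≮⇒≥ ¬p)

  module Charge (t : ℕ) where

    s M : ℕ
    s = suc t
    M = suc (suc (t + t))

    s+s≡M : s + s ≡ M
    s+s≡M = cong suc (+-suc t t)

    s<M : s < M
    s<M = s≤s (s≤s (m≤m+n t t))

    -- `anti` includes `h = h′`, which excludes `s`; with `shift`, the whole class of `s` is then
    -- empty, as is that of `0`.
    record Admissible (Q : ℕ → Set) : Set where
      field
        shift : ∀ h → Q (h + M) → Q h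
        anti  : ∀ {h h′} → Q h → Q h′ → h + h′ ≢ M
        zero∉ : ¬ Q 0

      shift-* : ∀ q {h} → Q (h + suc q * M) → Q (h + q * M)
      shift-* q {h} p = shift _ (subst Q (rearrange h M (q * M)) p)
        where
        rearrange : ∀ h m n → h + (m + n) ≡ h + n + m
        rearrange = solve-∀

      not-both : ∀ i → i ≤ s → Q (s + i) → Q (s ∸ i) → ⊥
      not-both i i≤s p q = anti p q (trans (+-assoc s i (s ∸ i)) (trans (cong (s +_) (m+[n∸m]≡n i≤s)) s+s≡M))

    -- Number of principal hooks in the residue class r < M; at most one summand is nonzero.
    charge : Vec ℤ t → ℕ → ℕ
    charge n r = at n (s ∸ r) ⁻ + at n (r ∸ s) ⁺

    charge-lower : ∀ n {i} → i ≤ s → charge n (s ∸ i) ≡ at n i ⁻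
    charge-lower n {i} i≤s = begin
      at n (s ∸ (s ∸ i)) ⁻ + at n (s ∸ i ∸ s) ⁺
        ≡⟨ cong₂ (λ j k → at n j ⁻ + at n k ⁺) (m∸[m∸n]≡n i≤s) (m≤n⇒m∸n≡0 (m∸n≤m s i)) ⟩
      at n i ⁻ + at n 0 ⁺       ≡⟨ cong (λ z → at n i ⁻ + z ⁺) (at-0 n) ⟩
      at n i ⁻ + 0              ≡⟨ +-identityʳ _ ⟩
      at n i ⁻                  ∎
      where open ≡-Reasoning

    charge-upper : ∀ n i → charge n (s + i) ≡ at n i ⁺
    charge-upper n i = begin
      at n (s ∸ (s + i)) ⁻ + at n (s + i ∸ s) ⁺
        ≡⟨ cong₂ (λ j k → at n j ⁻ + at n k ⁺) (m≤n⇒m∸n≡0 (m≤m+n s i)) (m+n∸m≡n s i) ⟩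
      at n 0 ⁻ + at n i ⁺       ≡⟨ cong (λ z → z ⁻ + at n i ⁺) (at-0 n) ⟩
      at n i ⁺                  ∎
      where open ≡-Reasoning

    charge-0 : ∀ n → charge n 0 ≡ 0
    charge-0 n = trans (cong (charge n) (sym (n∸n≡0 s)))
      (trans (charge-lower n ≤-refl) (cong _⁻ (at-outside n)))

    residue-cases : ∀ {r} → r < M → (∃ λ i → i ≤ s × r ≡ s ∸ i) ⊎ (∃ λ i → i < t × r ≡ s + suc i)
    residue-cases {r} r<M with r ≤? s
    ... | yes r≤s = inj₁ (s ∸ r , m∸n≤m s r , sym (m∸[m∸n]≡n r≤s))
    ... | no r≰s  = inj₂ (r ∸ suc s , i<t , sym r≡)
      where
      r≡ : s + suc (r ∸ suc s) ≡ r
      r≡ = trans (+-suc s _) (m+[n∸m]≡n (≰⇒> r≰s))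
      i<t : r ∸ suc s < t
      i<t = s≤s⁻¹ (+-cancelˡ-< s (suc (r ∸ suc s)) s (subst₂ _<_ (sym r≡) (sym s+s≡M) r<M))

    -- The set Δ prescribed by `n`: `h % M` is the class of `h`, and `h / M` its position there,
    -- counted from zero.
    record InDelta (n : Vec ℤ t) (h : ℕ) : Set where
      constructor inDelta
      field
        below-charge : h / M < charge n (h % M)

    open InDelta

    inDelta? : ∀ n → Decidable (InDelta n)
    inDelta? n h = map′ inDelta below-charge (h / M <? charge n (h % M))

    module _ {r} (r<M : r < M) (q : ℕ) where

      [r+qM]%M : (r + q * M) % M ≡ r
      [r+qM]%M = trans ([m+kn]%n≡m%n r q M) (m<n⇒m%n≡m r<M)

      [r+qM]/M : (r + q * M) / M ≡ q
      [r+qM]/M = trans (+-distrib-/-∣ʳ r (divides-refl q)) (cong₂ _+_ (m<n⇒m/n≡0 r<M) (m*n/n≡m q M))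

      inDelta⁺ : ∀ n → q < charge n r → InDelta n (r + q * M)
      inDelta⁺ n q< = inDelta (subst₂ (λ q r → q < charge n r) (sym [r+qM]/M) (sym [r+qM]%M) q<)

      inDelta⁻ : ∀ n → InDelta n (r + q * M) → q < charge n r
      inDelta⁻ n p = subst₂ (λ q r → q < charge n r) [r+qM]/M [r+qM]%M (below-charge p)

    divMod-eq : ∀ h → h % M + h / M * M ≡ h
    divMod-eq h = sym (m≡m%n+[m/n]*n h M)

    inDelta-0⁻ : ∀ n {r} → r < M → InDelta n r → 0 < charge n r
    inDelta-0⁻ n {r} r<M p = inDelta⁻ r<M 0 n (subst (InDelta n) (sym (+-identityʳ r)) p)

    inDelta-admissible : ∀ n → Admissible (InDelta n)
    inDelta-admissible n = record { shift = shift ; anti = anti ; zero∉ = zero∉ }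
      where
      rearrange : ∀ r q M → r + q * M + M ≡ r + suc q * M
      rearrange = solve-∀
      shift : ∀ h → InDelta n (h + M) → InDelta n h
      shift h p = inDelta (<-trans (n<1+n _) (inDelta⁻ (m%n<n h M) (suc (h / M)) n
        (subst (InDelta n) (trans (cong (_+ M) (sym (divMod-eq h))) (rearrange (h % M) (h / M) M)) p)))
      zero∉ : ¬ InDelta n 0
      zero∉ p = contradiction (subst (0 <_) (charge-0 n) (inDelta-0⁻ n (s≤s z≤n) p)) λ ()
      M∉ : ¬ InDelta n M
      M∉ p = zero∉ (shift 0 p)
      disjoint : ∀ z → 0 < z ⁻ → 0 < z ⁺ → ⊥
      disjoint (pos n)  () _
      disjoint -[1+ n ] _ ()
      -- If `h = s - i`, then `h′ = s + i`, and coordinate `i` would have both a positive and a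
      -- negative part. For `h = 0` the partner is `M`, in the empty class of `0`.
      anti-≤ : ∀ {h h′} → h ≤ s → InDelta n h → InDelta n h′ → h + h′ ≢ M
      anti-≤ {zero}  h≤s p p′ refl = M∉ p′
      anti-≤ {h@(suc _)} {h′} h≤s p p′ eq = disjoint (at n i)
        (subst (0 <_) (charge-lower n (m∸n≤m s h)) (subst (λ r → 0 < charge n r) h≡ (inDelta-0⁻ n (≤-<-trans h≤s s<M) p)))
        (subst (0 <_) (charge-upper n i) (subst (λ r → 0 < charge n r) h′≡ (inDelta-0⁻ n h′<M p′)))
        where
        i = s ∸ h
        h≡ : h ≡ s ∸ i
        h≡ = sym (m∸[m∸n]≡n h≤s)
        h′<M : h′ < M
        h′<M = subst (h′ <_) eq (m<n+m h′ (s≤s z≤n))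
        h′≡ : h′ ≡ s + i
        h′≡ = +-cancelˡ-≡ h h′ (s + i) (trans eq (trans (sym s+s≡M)
          (trans (cong (s +_) (sym (m+[n∸m]≡n h≤s))) (rearrange′ s h i))))
          where
          rearrange′ : ∀ s h i → s + (h + i) ≡ h + (s + i)
          rearrange′ = solve-∀
      anti : ∀ {h h′} → InDelta n h → InDelta n h′ → h + h′ ≢ M
      anti {h} {h′} p p′ eq with h ≤? s | h′ ≤? s
      ... | yes h≤s | _        = anti-≤ h≤s p p′ eq
      ... | no _    | yes h′≤s = anti-≤ h′≤s p′ p (trans (+-comm h′ h) eq)
      ... | no h≰s  | no h′≰s  = <-irrefl (trans s+s≡M (sym eq)) (+-mono-< (≰⇒> h≰s) (≰⇒> h′≰s))

    inDelta-injective : ∀ {n n′} → InDelta n ⊆ InDelta n′ → InDelta n′ ⊆ InDelta n → n ≡ n′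
    inDelta-injective {n} {n′} n⊆n′ n′⊆n = at-injective coordinate
      where
      charge≡ : ∀ {r} → r < M → charge n r ≡ charge n′ r
      charge≡ r<M = <-extensional
        (λ {q} q< → inDelta⁻ r<M q n′ (n⊆n′ (inDelta⁺ r<M q n q<)))
        (λ {q} q< → inDelta⁻ r<M q n (n′⊆n (inDelta⁺ r<M q n′ q<)))
      coordinate : ∀ i → i < t → at n (suc i) ≡ at n′ (suc i)
      coordinate i i<t = begin
        at n (suc i)                              ≡⟨ sym (⁺⊖⁻ _) ⟩
        at n (suc i) ⁺ ⊖ at n (suc i) ⁻           ≡⟨ cong₂ _⊖_ ⁺≡ ⁻≡ ⟩
        at n′ (suc i) ⁺ ⊖ at n′ (suc i) ⁻         ≡⟨ ⁺⊖⁻ _ ⟩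
        at n′ (suc i)                             ∎
        where
        open ≡-Reasoning
        upper<M : s + suc i < M
        upper<M = subst (s + suc i <_) s+s≡M (+-monoʳ-< s (s≤s i<t))
        ⁺≡ : at n (suc i) ⁺ ≡ at n′ (suc i) ⁺
        ⁺≡ = trans (sym (charge-upper n (suc i))) (trans (charge≡ upper<M) (charge-upper n′ (suc i)))
        i≤s : suc i ≤ s
        i≤s = s≤s (<⇒≤ i<t)
        ⁻≡ : at n (suc i) ⁻ ≡ at n′ (suc i) ⁻
        ⁻≡ = trans (sym (charge-lower n i≤s))
          (trans (charge≡ (≤-<-trans (m∸n≤m s (suc i)) s<M)) (charge-lower n′ i≤s))

    module Charges {Q : ℕ → Set} (Q? : Decidable Q) (fuel : ℕ) where

      count : ℕ → ℕ
      count r = height (λ q → Q? (r + q * M)) fuel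

      charges : Vec ℤ t
      charges = tabulate (λ p → count (s + suc (toℕ p)) ⊖ count (s ∸ suc (toℕ p)))

      module _ (adm : Admissible Q) (bound : ∀ {h} → Q h → h < fuel) where
        open Admissible adm

        count⁻ : ∀ r {q} → q < count r → Q (r + q * M)
        count⁻ r = height⁻ (λ q → Q? (r + q * M)) fuel

        count⁺ : ∀ r {q} → Q (r + q * M) → q < count r
        count⁺ r = height⁺ (λ q → Q? (r + q * M)) (λ q → shift-* q) fuel
          -- `r + fuel * M` is at least `fuel`, hence beyond every element of `Q`, and the run ends
          -- in time.
          λ p → <⇒≱ (bound p) (≤-trans (m≤m*n fuel M) (m≤n+m (fuel * M) r))

        count-0⁻ : ∀ r → 0 < count r → Q r
        count-0⁻ r p = subst Q (+-identityʳ r) (count⁻ r p)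

        count-disjoint : ∀ i → i ≤ s → count (s + i) ≡ 0 ⊎ count (s ∸ i) ≡ 0
        count-disjoint i i≤s with 0 <? count (s + i) | 0 <? count (s ∸ i)
        ... | no ¬p | _     = inj₁ (¬positive⇒≡0 ¬p)
        ... | yes _ | no ¬q = inj₂ (¬positive⇒≡0 ¬q)
        ... | yes p | yes q = ⊥-elim (not-both i i≤s (count-0⁻ (s + i) p) (count-0⁻ (s ∸ i) q))

        at-charges : ∀ {i} → i < t → at charges (suc i) ≡ count (s + suc i) ⊖ count (s ∸ suc i)
        at-charges = at-tabulate (λ i → count (s + suc i) ⊖ count (s ∸ suc i))

        -- The two ends of the range are the classes without a coordinate: `i = 0` is the class of
        -- `s`, empty since `s + s` is `M`, and `i = s` is the class of `0`.
        charge-lower-count : ∀ i → i ≤ s → at charges i ⁻ ≡ count (s ∸ i)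
        charge-lower-count zero _ = trans (cong _⁻ (at-0 charges))
          (sym (¬positive⇒≡0 λ p → anti (count-0⁻ s p) (count-0⁻ s p) s+s≡M))
        charge-lower-count (suc i) (s≤s i≤t) with i <? t
        ... | yes i<t = trans (cong _⁻ (at-charges i<t)) (⊖-⁻ (count-disjoint (suc i) (s≤s i≤t)))
        ... | no i≮t with refl ← ≤-antisym i≤t (≮⇒≥ i≮t) = trans (cong _⁻ (at-outside charges))
          (sym (¬positive⇒≡0 λ p → zero∉ (subst Q (n∸n≡0 s) (count-0⁻ (s ∸ s) p))))

        charge≡count : ∀ {r} → r < M → charge charges r ≡ count r
        charge≡count r<M with residue-cases r<M
        ... | inj₁ (i , i≤s , refl) = trans (charge-lower charges i≤s) (charge-lower-count i i≤s)
        ... | inj₂ (i , i<t , refl) = trans (charge-upper charges (suc i))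
          (trans (cong _⁺ (at-charges i<t)) (⊖-⁺ (count-disjoint (suc i) (s≤s (<⇒≤ i<t)))))

        charges⁺ : Q ⊆ InDelta charges
        charges⁺ {h} p = inDelta (subst (h / M <_) (sym (charge≡count (m%n<n h M)))
          (count⁺ (h % M) (subst Q (sym (divMod-eq h)) p)))

        charges⁻ : InDelta charges ⊆ Q
        charges⁻ {h} p = subst Q (divMod-eq h)
          (count⁻ (h % M) (subst (h / M <_) (charge≡count (m%n<n h M)) (below-charge p)))

  -- Parity of hooks

  parity-split : ∀ h → ∃ λ e → ∃ λ a → e ≤ 1 × h ≡ e + (a + a)
  parity-split zero          = 0 , 0 , z≤n , refl
  parity-split (suc zero)    = 1 , 0 , ≤-refl , refl
  parity-split (suc (suc h)) with parity-split h
  ... | e , a , e≤1 , eq = e , suc a , e≤1 , trans (cong (λ x → suc (suc x)) eq) (rearrange e a)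
    where
    rearrange : ∀ e a → suc (suc (e + (a + a))) ≡ e + (suc a + suc a)
    rearrange = solve-∀

  half-parity : ∀ {e a} → e ≤ 1 → ⌊ e + (a + a) /2⌋ ≡ a
  half-parity {a = a} z≤n       = sym (n≡⌊n+n/2⌋ a)
  half-parity {a = a} (s≤s z≤n) = sym (n≡⌈n+n/2⌉ a)

  parity-unique : ∀ {e e′ a a′} → e ≤ 1 → e′ ≤ 1 → e + (a + a) ≡ e′ + (a′ + a′) → e ≡ e′ × a ≡ a′
  parity-unique {e} {e′} {a} {a′} e≤1 e′≤1 eq = e≡e′ , a≡a′
    where
    a≡a′ : a ≡ a′
    a≡a′ = trans (sym (half-parity e≤1)) (trans (cong ⌊_/2⌋ eq) (half-parity e′≤1))
    e≡e′ : e ≡ e′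
    e≡e′ = +-cancelʳ-≡ (a + a) e e′ (trans eq (cong (λ x → e′ + (x + x)) (sym a≡a′)))

  ∈⇒≤-sum : ∀ {h xs} → h ∈ xs → h ≤ sum xs
  ∈⇒≤-sum (here refl)      = m≤m+n _ _
  ∈⇒≤-sum {xs = x ∷ _} (there h∈) = ≤-trans (∈⇒≤-sum h∈) (m≤n+m _ x)

  -- Finite sums

  -- Peels off the largest index first, in step with `downFrom`.
  ∑ : ℕ → (ℕ → ℕ) → ℕ
  ∑ zero    f = 0
  ∑ (suc n) f = f n + ∑ n f

  ∑-cong : ∀ n {f g} → (∀ i → i < n → f i ≡ g i) → ∑ n f ≡ ∑ n g
  ∑-cong zero    eq = refl
  ∑-cong (suc n) eq = cong₂ _+_ (eq n ≤-refl) (∑-cong n λ i i<n → eq i (m≤n⇒m≤1+n i<n))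

  ∑-head : ∀ n (f : ℕ → ℕ) → ∑ (suc n) f ≡ f 0 + ∑ n (f ∘ suc)
  ∑-head zero    f = refl
  ∑-head (suc n) f = trans (cong (f (suc n) +_) (∑-head n f)) (rearrange (f (suc n)) (f 0) _)
    where
    rearrange : ∀ a b c → a + (b + c) ≡ b + (a + c)
    rearrange = solve-∀

  ∑-reverse : ∀ n (f : ℕ → ℕ) → ∑ n (λ i → f (n ∸ i)) ≡ ∑ n (f ∘ suc)
  ∑-reverse zero    f = refl
  ∑-reverse (suc n) f = trans (∑-head n (λ i → f (suc n ∸ i))) (cong (f (suc n) +_) (∑-reverse n f))

  ∑-distrib-+ : ∀ n f g → ∑ n (λ i → f i + g i) ≡ ∑ n f + ∑ n g
  ∑-distrib-+ zero    f g = refl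
  ∑-distrib-+ (suc n) f g = trans (cong (f n + g n +_) (∑-distrib-+ n f g)) (rearrange (f n) (g n) _ _)
    where
    rearrange : ∀ a b c d → a + b + (c + d) ≡ (a + c) + (b + d)
    rearrange = solve-∀

  ∑-0 : ∀ n → ∑ n (λ _ → 0) ≡ 0
  ∑-0 zero    = refl
  ∑-0 (suc n) = ∑-0 n

  ∑-swap : ∀ m n (f : ℕ → ℕ → ℕ) → ∑ m (λ i → ∑ n (f i)) ≡ ∑ n (λ j → ∑ m (λ i → f i j))
  ∑-swap zero    n f = sym (∑-0 n)
  ∑-swap (suc m) n f = trans (cong (∑ n (f m) +_) (∑-swap m n f)) (sym (∑-distrib-+ n (f m) _))

  ∑-+ : ∀ m n f → ∑ (m + n) f ≡ ∑ m (λ i → f (i + n)) + ∑ n f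
  ∑-+ zero    n f = refl
  ∑-+ (suc m) n f = trans (cong (f (m + n) +_) (∑-+ m n f)) (sym (+-assoc (f (m + n)) _ _))

  ∑-* : ∀ k m f → ∑ (k * m) f ≡ ∑ k (λ q → ∑ m (λ r → f (r + q * m)))
  ∑-* zero    m f = refl
  ∑-* (suc k) m f = trans (∑-+ m (k * m) f) (cong (∑ m (λ r → f (r + k * m)) +_) (∑-* k m f))

  ∑-parity : ∀ n f → ∑ n (λ a → f (1 + (a + a))) + ∑ n (λ a → f (a + a)) ≡ ∑ (n + n) f
  ∑-parity zero    f = refl
  ∑-parity (suc n) f = begin
    f (1 + (n + n)) + ∑ n (λ a → f (1 + (a + a))) + (f (n + n) + ∑ n (λ a → f (a + a)))
      ≡⟨ rearrange (f (1 + (n + n))) _ (f (n + n)) _ ⟩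
    f (1 + (n + n)) + (f (n + n) + (∑ n (λ a → f (1 + (a + a))) + ∑ n (λ a → f (a + a))))
      ≡⟨ cong (λ x → f (1 + (n + n)) + (f (n + n) + x)) (∑-parity n f) ⟩
    ∑ (2 + (n + n)) f
      ≡⟨ cong (λ k → ∑ (suc k) f) (sym (+-suc n n)) ⟩
    ∑ (suc n + suc n) f ∎
    where
    open ≡-Reasoning
    rearrange : ∀ a b c d → a + b + (c + d) ≡ a + (c + (b + d))
    rearrange = solve-∀

  ∑-truncate : ∀ {f g c} n → c ≤ n → (∀ q → q < c → f q ≡ g q) → (∀ q → c ≤ q → f q ≡ 0) → ∑ n f ≡ ∑ c g
  ∑-truncate zero    z≤n eq vanish = refl
  ∑-truncate {c = c} (suc n) c≤ eq vanish with c ≤? n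
  ... | yes c≤n = cong₂ _+_ (vanish n c≤n) (∑-truncate n c≤n eq vanish)
  ... | no c≰n with refl ← ≤-antisym c≤ (≰⇒> c≰n) = ∑-cong (suc n) eq

  sum-filter-downFrom : ∀ {P : ℕ → Set} (P? : Decidable P) g n →
    sum (map g (filter P? (downFrom n))) ≡ ∑ n (λ a → if does (P? a) then g a else 0)
  sum-filter-downFrom P? g zero = refl
  sum-filter-downFrom P? g (suc n) with P? n
  ... | yes _ = cong (g n +_) (sum-filter-downFrom P? g n)
  ... | no _  = sum-filter-downFrom P? g n

  ∑≡foldr : ∀ t (f : ℕ → ℕ) (g : Fin t → ℤ) → (∀ p → pos (f (toℕ p)) ≡ g p) →
    pos (∑ t f) ≡ foldr _ℤ+_ (pos 0) (toList (tabulate g))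
  ∑≡foldr zero    f g eq = refl
  ∑≡foldr (suc t) f g eq = trans (cong pos (∑-head t f))
    (cong₂ _ℤ+_ (eq Fin.zero) (∑≡foldr t (f ∘ suc) (g ∘ Fin.suc) (λ p → eq (Fin.suc p))))

  -- Maxima with a default value

  ≤-foldr-⊔ : ∀ b xs → b ℤ≤ foldr _⊔_ b (map pos xs)
  ≤-foldr-⊔ b []       = ℤP.≤-refl
  ≤-foldr-⊔ b (x ∷ xs) = ℤP.≤-trans (≤-foldr-⊔ b xs) (ℤP.i≤j⊔i (pos x) _)

  ∈⇒≤-foldr-⊔ : ∀ b {xs h} → h ∈ xs → pos h ℤ≤ foldr _⊔_ b (map pos xs)
  ∈⇒≤-foldr-⊔ b (here refl)      = ℤP.i≤i⊔j _ _
  ∈⇒≤-foldr-⊔ b {x ∷ _} (there h∈) = ℤP.≤-trans (∈⇒≤-foldr-⊔ b h∈) (ℤP.i≤j⊔i (pos x) _)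

  foldr-⊔-lub : ∀ {b v} xs → b ℤ≤ v → (∀ {h} → h ∈ xs → pos h ℤ≤ v) → foldr _⊔_ b (map pos xs) ℤ≤ v
  foldr-⊔-lub []       b≤v ub = b≤v
  foldr-⊔-lub (x ∷ xs) b≤v ub = ℤP.⊔-lub (ub (here refl)) (foldr-⊔-lub xs b≤v (ub ∘ there))

  -%ℕ : ∀ {d k} .{{_ : NonZero d}} → suc k < d → -[1+ k ] %ℕ d ≡ d ∸ suc k
  -%ℕ {d} {k} k<d with suc k % d | m<n⇒m%n≡m k<d
  ... | _ | refl = refl

  -- Partitions and charge vectors

  module Correspondence (t : ℕ) where

    open Charge t

    -- Indexed by the parity of the principal hooks, which is also the `e` of `Shifted`, so that
    -- both partitions are handled by one argument.
    component : List ℕ × List ℕ → ℕ → List ℕ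
    component (l , m) zero    = m
    component (l , m) (suc _) = l

    hooks : List ℕ × List ℕ → List ℕ
    hooks (l , m) = principalHooks l ++ principalHooks m

    record Valid (e : ℕ) (l : List ℕ) : Set where
      field
        isPartition : IsPartition l
        isCore      : IsCore s l
        shifted     : Shifted e l

      decreasing : Decreasing l
      decreasing = proj₁ isPartition

    valid : (x : SCDD t) → ∀ {e} → e ≤ 1 → Valid e (component (proj₁ x) e)
    valid ((l , m) , _ , p , c , dd) z≤n = record
      { isPartition = p ; isCore = c ; shifted = doubledDistinct⇒shifted {m} (proj₁ p) dd }
    valid ((l , m) , (p , c , sc) , _) (s≤s z≤n) = record
      { isPartition = p ; isCore = c ; shifted = selfConj⇒shifted {l} sc }

    toSCDD : ∀ {l m} → Valid 1 l → Valid 0 m → SCDD t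
    toSCDD {l} {m} v w = (l , m) ,
      (V.isPartition , V.isCore , shifted⇒selfConj V.decreasing V.shifted) ,
      (W.isPartition , W.isCore , shifted⇒doubledDistinct W.decreasing W.shifted)
      where
      module V = Valid v
      module W = Valid w

    hooks⁺ : ∀ x {e a} → e ≤ 1 → Arm (component (proj₁ x) e) a → e + (a + a) ∈ hooks (proj₁ x)
    hooks⁺ x z≤n arm = ∈-++⁺ʳ (principalHooks (proj₁ (proj₁ x)))
      (∈-principalHooks⁺ V.decreasing V.shifted arm)
      where module V = Valid (valid x z≤n)
    hooks⁺ x (s≤s z≤n) arm = ∈-++⁺ˡ (∈-principalHooks⁺ V.decreasing V.shifted arm)
      where module V = Valid (valid x (s≤s z≤n))

    -- Each of the two lists contains hooks of one parity only, so the parity of a member of the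
    -- concatenation tells its origin.
    hooks⁻ : ∀ x {e a} → e ≤ 1 → e + (a + a) ∈ hooks (proj₁ x) → Arm (component (proj₁ x) e) a
    hooks⁻ x {e} {a} e≤1 h∈ =
      [ (λ h∈l → convert ≤-refl (∈-principalHooks⁻ V.decreasing V.shifted h∈l))
      , (λ h∈m → convert z≤n (∈-principalHooks⁻ W.decreasing W.shifted h∈m)) ]′
      (∈-++⁻ (principalHooks (proj₁ (proj₁ x))) h∈)
      where
      module V = Valid (valid x {1} ≤-refl)
      module W = Valid (valid x {0} z≤n)
      convert : ∀ {e′} → e′ ≤ 1 → (∃ λ b → Arm (component (proj₁ x) e′) b × e + (a + a) ≡ e′ + (b + b)) →
        Arm (component (proj₁ x) e) a
      convert e′≤1 (b , arm , eq) with refl , refl ← parity-unique {a = a} {b} e≤1 e′≤1 eq = arm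

    module _ (x : SCDD t) where

      hooks-admissible : Admissible (_∈ hooks (proj₁ x))
      hooks-admissible = record { shift = shift ; anti = anti ; zero∉ = zero∉ }
        where
        rearrange : ∀ e a s → e + (a + a) + (s + s) ≡ e + ((a + s) + (a + s))
        rearrange = solve-∀
        shift : ∀ h → h + M ∈ hooks (proj₁ x) → h ∈ hooks (proj₁ x)
        shift h h∈ with parity-split h
        ... | e , a , e≤1 , refl = hooks⁺ x e≤1 (core⇒distanceClosed (s≤s z≤n) V.decreasing V.isCore a
          (hooks⁻ x e≤1 (subst (_∈ hooks (proj₁ x))
            (trans (cong (e + (a + a) +_) (sym s+s≡M)) (rearrange e a s)) h∈)))
          where module V = Valid (valid x e≤1)
        double : ∀ e a b → (e + (a + a)) + (e + (b + b)) ≡ 0 + ((e + (a + b)) + (e + (a + b)))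
        double = solve-∀
        odd : ∀ a b → (1 + (a + a)) + (0 + (b + b)) ≡ 1 + ((a + b) + (a + b))
        odd = solve-∀
        mixed : ∀ a b → (1 + (a + a)) + (0 + (b + b)) ≢ M
        mixed a b eq = contradiction
          (proj₁ (parity-unique {1} {0} {a + b} {s} ≤-refl z≤n (trans (sym (odd a b)) (trans eq (sym s+s≡M)))))
          λ ()
        same : ∀ {e} → e ≤ 1 → ∀ a b → e + (a + a) ∈ hooks (proj₁ x) → e + (b + b) ∈ hooks (proj₁ x) →
          (e + (a + a)) + (e + (b + b)) ≢ M
        same {e} e≤1 a b h∈ h′∈ eq = core⇒sumFree (s≤s z≤n) V.decreasing V.shifted V.isCore a b
          (hooks⁻ x e≤1 h∈) (hooks⁻ x e≤1 h′∈)
          (proj₂ (parity-unique {0} {0} {e + (a + b)} {s} z≤n z≤n (trans (sym (double e a b)) (trans eq (sym s+s≡M)))))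
          where module V = Valid (valid x e≤1)
        anti : ∀ {h h′} → h ∈ hooks (proj₁ x) → h′ ∈ hooks (proj₁ x) → h + h′ ≢ M
        anti {h} {h′} h∈ h′∈ with parity-split h | parity-split h′
        ... | _ , a , z≤n , refl     | _ , b , z≤n , refl     = same z≤n a b h∈ h′∈
        ... | _ , a , s≤s z≤n , refl | _ , b , s≤s z≤n , refl = same ≤-refl a b h∈ h′∈
        ... | _ , a , s≤s z≤n , refl | _ , b , z≤n , refl     = mixed a b
        ... | _ , a , z≤n , refl     | _ , b , s≤s z≤n , refl = mixed b a ∘ trans (+-comm (1 + (b + b)) (a + a))
        zero∉ : ¬ 0 ∈ hooks (proj₁ x)
        zero∉ 0∈ = ¬arm-0 V.decreasing V.shifted (hooks⁻ x {0} {0} z≤n 0∈)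
          where module V = Valid (valid x {0} z≤n)

      -- No hook exceeds the sum of all hooks, so its successor is enough fuel. The value depends
      -- only on the underlying pair of partitions.
      φ : Vec ℤ t
      φ = Charges.charges (_∈? hooks (proj₁ x)) (suc (sum (hooks (proj₁ x))))

      ∈-hooks⇒inDelta : ∀ {h} → h ∈ hooks (proj₁ x) → InDelta φ h
      ∈-hooks⇒inDelta = Charges.charges⁺ (_∈? hooks (proj₁ x)) _ hooks-admissible (s≤s ∘ ∈⇒≤-sum)

      inDelta⇒∈-hooks : ∀ {h} → InDelta φ h → h ∈ hooks (proj₁ x)
      inDelta⇒∈-hooks = Charges.charges⁻ (_∈? hooks (proj₁ x)) _ hooks-admissible (s≤s ∘ ∈⇒≤-sum)

    hooks-injective : ∀ x y → (∀ {h} → h ∈ hooks (proj₁ x) → h ∈ hooks (proj₁ y)) →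
      (∀ {h} → h ∈ hooks (proj₁ y) → h ∈ hooks (proj₁ x)) → proj₁ x ≡ proj₁ y
    hooks-injective x y x⊆y y⊆x = cong₂ _,_ (component≡ ≤-refl) (component≡ z≤n)
      where
      component≡ : ∀ {e} → e ≤ 1 → component (proj₁ x) e ≡ component (proj₁ y) e
      component≡ e≤1 = arms-determine V.isPartition W.isPartition V.shifted W.shifted
        (hooks⁻ y e≤1 ∘ x⊆y ∘ hooks⁺ x e≤1) (hooks⁻ x e≤1 ∘ y⊆x ∘ hooks⁺ y e≤1)
        where
        module V = Valid (valid x e≤1)
        module W = Valid (valid y e≤1)

    -- The inverse map and the weight

    module _ (n : Vec ℤ t) where

      open Admissible (inDelta-admissible n)

      -- Chosen so that `armBound + armBound` equals `chargeBound * M`: the same interval of hooks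
      -- can be cut both by parity and by residue class.
      chargeBound armBound : ℕ
      chargeBound = size n + size n
      armBound    = chargeBound * s

      charge≤chargeBound : ∀ r → charge n r ≤ chargeBound
      charge≤chargeBound r = +-mono-≤
        (≤-trans (⁻≤∣∣ (at n (s ∸ r))) (∣at∣≤size n (s ∸ r)))
        (≤-trans (⁺≤∣∣ (at n (r ∸ s))) (∣at∣≤size n (r ∸ s)))

      armBound+armBound : armBound + armBound ≡ chargeBound * M
      armBound+armBound = trans (sym (*-distribˡ-+ chargeBound s s)) (cong (chargeBound *_) s+s≡M)

      inDelta-bounded : ∀ {h} → InDelta n h → h < armBound + armBound
      inDelta-bounded {h} (inDelta q<c) = begin-strict
        h                          ≡⟨ sym (divMod-eq h) ⟩
        h % M + h / M * M          <⟨ +-monoˡ-< (h / M * M) (m%n<n h M) ⟩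
        suc (h / M) * M            ≤⟨ *-monoˡ-≤ M (≤-trans q<c (charge≤chargeBound (h % M))) ⟩
        chargeBound * M            ≡⟨ sym armBound+armBound ⟩
        armBound + armBound        ∎
        where open ≤-Reasoning

      arm? : ∀ e → Decidable (λ a → InDelta n (e + (a + a)))
      arm? e a = inDelta? n (e + (a + a))

      arms : ℕ → List ℕ
      arms e = filter (arm? e) (downFrom armBound)

      ∈-arms⁺ : ∀ {e a} → InDelta n (e + (a + a)) → a ∈ arms e
      ∈-arms⁺ {e} {a} p = ∈-filter⁺ (arm? e) (∈-downFrom⁺ a<) p
        where
        a< : a < armBound
        a< = ≰⇒> λ b≤a → <⇒≱ (inDelta-bounded p) (≤-trans (+-mono-≤ b≤a b≤a) (m≤n+m (a + a) e))

      ∈-arms⁻ : ∀ {e a} → a ∈ arms e → InDelta n (e + (a + a))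
      ∈-arms⁻ {e} a∈ = proj₂ (∈-filter⁻ (arm? e) {xs = downFrom armBound} a∈)

      arms-decreasing : ∀ e → Linked _>_ (arms e)
      arms-decreasing e = linked-filter⁺ (arm? e) (flip <-trans) (applyDownFrom⁺₂ id armBound λ _ → ≤-refl)

      arms-positive : ∀ e → All (λ a → 0 < e + a) (arms e)
      arms-positive e = All.tabulate λ {a} a∈ → n≢0⇒n>0 λ e+a≡0 →
        zero∉ (subst (InDelta n)
          (cong₂ (λ e a → e + (a + a)) (m+n≡0⇒m≡0 e e+a≡0) (m+n≡0⇒n≡0 e e+a≡0)) (∈-arms⁻ {e} a∈))

      built : ℕ → List ℕ
      built e = build e (arms e)

      built-arm⁺ : ∀ {e a} → InDelta n (e + (a + a)) → Arm (built e) a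
      built-arm⁺ {e} p = build-arm⁺ e (arms-decreasing e) (arms-positive e) (∈-arms⁺ {e} p)

      built-arm⁻ : ∀ {e a} → Arm (built e) a → InDelta n (e + (a + a))
      built-arm⁻ {e} arm = ∈-arms⁻ {e} (build-arm⁻ e (arms-decreasing e) (arms-positive e) arm)

      built-valid : ∀ {e} → e ≤ 1 → Valid e (built e)
      built-valid {e} e≤1 = record
        { isPartition = partition
        ; isCore      = core-criterion e≤1 (proj₁ partition) sh distanceClosed sumFree
        ; shifted     = sh
        }
        where
        partition = build-isPartition e (arms-decreasing e)
        sh = build-shifted e (arms-decreasing e) (arms-positive e)
        rearrange₁ : ∀ e a s → e + ((a + s) + (a + s)) ≡ e + (a + a) + (s + s)
        rearrange₁ = solve-∀
        distanceClosed : DistanceClosed s (Arm (built e))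
        distanceClosed a arm = built-arm⁺ (shift (e + (a + a)) (subst (InDelta n)
          (trans (rearrange₁ e a s) (cong (e + (a + a) +_) s+s≡M)) (built-arm⁻ arm)))
        rearrange₂ : ∀ e a b → (e + (a + a)) + (e + (b + b)) ≡ (e + (a + b)) + (e + (a + b))
        rearrange₂ = solve-∀
        sumFree : SumFree e s (Arm (built e))
        sumFree a b arm arm′ eq = anti (built-arm⁻ arm) (built-arm⁻ arm′)
          (trans (rearrange₂ e a b) (trans (cong₂ _+_ eq eq) s+s≡M))

      ψ : SCDD t
      ψ = toSCDD (built-valid ≤-refl) (built-valid z≤n)

      ψ-component : ∀ {e} → e ≤ 1 → component (proj₁ ψ) e ≡ built e
      ψ-component z≤n       = refl
      ψ-component (s≤s z≤n) = refl

      inDelta⇒∈-hooks-ψ : ∀ {h} → InDelta n h → h ∈ hooks (proj₁ ψ)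
      inDelta⇒∈-hooks-ψ {h} p with parity-split h
      ... | e , a , e≤1 , refl =
        hooks⁺ ψ e≤1 (subst (λ l → Arm l a) (sym (ψ-component e≤1)) (built-arm⁺ p))

      ∈-hooks-ψ⇒inDelta : ∀ {h} → h ∈ hooks (proj₁ ψ) → InDelta n h
      ∈-hooks-ψ⇒inDelta {h} h∈ with parity-split h
      ... | e , a , e≤1 , refl =
        built-arm⁻ (subst (λ l → Arm l a) (ψ-component e≤1) (hooks⁻ ψ e≤1 h∈))

      masked : ℕ → ℕ
      masked h = if does (inDelta? n h) then h else 0

      progression : ℕ → ℕ → ℕ
      progression r c = ∑ c (λ q → r + q * M)

      ∑-masked : ∀ {r} → r < M → ∑ chargeBound (λ q → masked (r + q * M)) ≡ progression r (charge n r)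
      ∑-masked {r} r<M = ∑-truncate chargeBound (charge≤chargeBound r) inside outside
        where
        inside : ∀ q → q < charge n r → masked (r + q * M) ≡ r + q * M
        inside q q< = cong (if_then r + q * M else 0) (dec-true (inDelta? n (r + q * M)) (inDelta⁺ r<M q n q<))
        outside : ∀ q → charge n r ≤ q → masked (r + q * M) ≡ 0
        outside q c≤q = cong (if_then r + q * M else 0)
          (dec-false (inDelta? n (r + q * M)) λ p → ≤⇒≯ c≤q (inDelta⁻ r<M q n p))

      weight-built : ∀ e → weight (built e) ≡ ∑ armBound (λ a → masked (e + (a + a)))
      weight-built e = trans (build-weight e (arms-decreasing e) (arms-positive e))
        (sum-filter-downFrom (arm? e) (λ a → e + (a + a)) armBound)

      summand : ℕ → ℕ
      summand i = progression (s + suc i) (at n (suc i) ⁺) + progression (s ∸ suc i) (at n (suc i) ⁻)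

      -- The elements of Δ are summed over a full interval, with zeros off Δ; this sum is regrouped
      -- from parities to residue classes, the empty classes of `0` and `s` drop out, and the others
      -- are paired.
      weight-ψ : weight (built 1) + weight (built 0) ≡ ∑ t summand
      weight-ψ = begin
        weight (built 1) + weight (built 0)
          ≡⟨ cong₂ _+_ (weight-built 1) (weight-built 0) ⟩
        ∑ armBound (λ a → masked (1 + (a + a))) + ∑ armBound (λ a → masked (a + a))
          ≡⟨ ∑-parity armBound masked ⟩
        ∑ (armBound + armBound) masked
          ≡⟨ cong (λ k → ∑ k masked) armBound+armBound ⟩
        ∑ (chargeBound * M) masked
          ≡⟨ ∑-* chargeBound M masked ⟩
        ∑ chargeBound (λ q → ∑ M (λ r → masked (r + q * M)))
          ≡⟨ ∑-swap chargeBound M (λ q r → masked (r + q * M)) ⟩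
        ∑ M (λ r → ∑ chargeBound (λ q → masked (r + q * M)))
          ≡⟨ ∑-cong M (λ r r<M → ∑-masked r<M) ⟩
        ∑ M block
          ≡⟨ cong (λ k → ∑ k block) (sym s+s≡M) ⟩
        ∑ (s + s) block
          ≡⟨ ∑-+ s s block ⟩
        ∑ s (λ i → block (i + s)) + ∑ s block
          ≡⟨ cong₂ _+_ (∑-head t (λ i → block (i + s))) (∑-head t block) ⟩
        block s + ∑ t (λ i → block (suc i + s)) + (block 0 + ∑ t (block ∘ suc))
          ≡⟨ cong₂ (λ x y → x + ∑ t (λ i → block (suc i + s)) + (y + ∑ t (block ∘ suc))) block-s block-0 ⟩
        ∑ t (λ i → block (suc i + s)) + ∑ t (block ∘ suc)
          -- The lower classes are listed downwards, because `t ∸ i` is `s ∸ suc i`, the partner of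
          -- `s + suc i`.
          ≡⟨ cong (∑ t (λ i → block (suc i + s)) +_) (sym (∑-reverse t block)) ⟩
        ∑ t (λ i → block (suc i + s)) + ∑ t (λ i → block (t ∸ i))
          ≡⟨ sym (∑-distrib-+ t (λ i → block (suc i + s)) (λ i → block (t ∸ i))) ⟩
        ∑ t (λ i → block (suc i + s) + block (t ∸ i))
          ≡⟨ ∑-cong t (λ i i<t → cong₂ _+_ (block-upper i) (cong (progression (t ∸ i)) (charge-lower n (s≤s (<⇒≤ i<t))))) ⟩
        ∑ t summand ∎
        where
        open ≡-Reasoning
        block : ℕ → ℕ
        block r = progression r (charge n r)
        block-0 : block 0 ≡ 0
        block-0 = cong (progression 0) (charge-0 n)
        block-s : block s ≡ 0
        block-s = cong (progression s) (trans (charge-lower n z≤n) (cong _⁻ (at-0 n)))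
        block-upper : ∀ i → block (suc i + s) ≡ progression (s + suc i) (at n (suc i) ⁺)
        block-upper i = trans (cong block (+-comm (suc i) s)) (cong (progression (s + suc i)) (charge-upper n (suc i)))

      -- The closed form c r + s c (c − 1), moved so that no subtraction occurs.
      progression-closed : ∀ r c → progression r c + c * s ≡ c * r + s * (c * c)
      progression-closed r zero    = sym (*-zeroʳ s)
      progression-closed r (suc c) = begin
        r + c * M + progression r c + suc c * s
          ≡⟨ cong (λ m → r + c * m + progression r c + suc c * s) (sym s+s≡M) ⟩
        r + c * (s + s) + progression r c + suc c * s      ≡⟨ rearrange₁ r c s (progression r c) ⟩
        r + c * (s + s) + s + (progression r c + c * s)
          ≡⟨ cong (r + c * (s + s) + s +_) (progression-closed r c) ⟩
        r + c * (s + s) + s + (c * r + s * (c * c))        ≡⟨ rearrange₂ r c s ⟩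
        suc c * r + s * (suc c * suc c)                    ∎
        where
        open ≡-Reasoning
        rearrange₁ : ∀ r c s p → r + c * (s + s) + p + suc c * s ≡ r + c * (s + s) + s + (p + c * s)
        rearrange₁ = solve-∀
        rearrange₂ : ∀ r c s → r + c * (s + s) + s + (c * r + s * (c * c)) ≡ suc c * r + s * (suc c * suc c)
        rearrange₂ = solve-∀

      progression-upper : ∀ i c → progression (s + i) c ≡ s * (c * c) + i * c
      progression-upper i c = +-cancelʳ-≡ (c * s) _ _ (trans (progression-closed (s + i) c) (rearrange s i c))
        where
        rearrange : ∀ s i c → c * (s + i) + s * (c * c) ≡ s * (c * c) + i * c + c * s
        rearrange = solve-∀

      progression-lower : ∀ {i} c → i ≤ s → progression (s ∸ i) c + i * c ≡ s * (c * c)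
      progression-lower {i} c i≤s = +-cancelʳ-≡ (c * s) _ _ (begin
        progression (s ∸ i) c + i * c + c * s    ≡⟨ rearrange₁ _ (i * c) (c * s) ⟩
        progression (s ∸ i) c + c * s + i * c    ≡⟨ cong (_+ i * c) (progression-closed (s ∸ i) c) ⟩
        c * (s ∸ i) + s * (c * c) + i * c        ≡⟨ rearrange₂ c (s ∸ i) (s * (c * c)) i ⟩
        s * (c * c) + c * (s ∸ i + i)            ≡⟨ cong (λ k → s * (c * c) + c * k) (m∸n+n≡m i≤s) ⟩
        s * (c * c) + c * s                      ∎)
        where
        open ≡-Reasoning
        rearrange₁ : ∀ p a b → p + a + b ≡ p + b + a
        rearrange₁ = solve-∀
        rearrange₂ : ∀ c d x i → c * d + x + i * c ≡ x + c * (d + i)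
        rearrange₂ = solve-∀

      -- For either sign one of the two progressions is empty, and the linear term of the other
      -- takes the sign of the coordinate.
      summand-closed : ∀ i → i < t →
        pos (summand i) ≡ pos s ℤ* (at n (suc i) ℤ* at n (suc i)) ℤ+ pos (suc i) ℤ* at n (suc i)
      summand-closed i i<t with at n (suc i)
      ... | pos c = begin
        pos (progression (s + suc i) c + 0)
          ≡⟨ cong pos (trans (+-identityʳ _) (progression-upper (suc i) c)) ⟩
        pos (s * (c * c)) ℤ+ pos (suc i * c)
          ≡⟨ cong₂ _ℤ+_ (trans (ℤP.pos-* s (c * c)) (cong (pos s ℤ*_) (ℤP.pos-* c c))) (ℤP.pos-* (suc i) c) ⟩
        pos s ℤ* (pos c ℤ* pos c) ℤ+ pos (suc i) ℤ* pos c  ∎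
        where open ≡-Reasoning
      ... | -[1+ c′ ] = begin
        pos G                                                ≡⟨ rearrange₁ (pos G) (pos (suc i) ℤ* pos c) ⟩
        pos G ℤ+ pos (suc i) ℤ* pos c ℤ- pos (suc i) ℤ* pos c
          ≡⟨ cong (λ z → pos G ℤ+ z ℤ- pos (suc i) ℤ* pos c) (sym (ℤP.pos-* (suc i) c)) ⟩
        pos (G + suc i * c) ℤ- pos (suc i) ℤ* pos c
          ≡⟨ cong (λ z → pos z ℤ- pos (suc i) ℤ* pos c) (progression-lower c (s≤s (<⇒≤ i<t))) ⟩
        pos (s * (c * c)) ℤ- pos (suc i) ℤ* pos c
          ≡⟨ cong (_ℤ- pos (suc i) ℤ* pos c) (trans (ℤP.pos-* s (c * c)) (cong (pos s ℤ*_) (ℤP.pos-* c c))) ⟩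
        pos s ℤ* (pos c ℤ* pos c) ℤ- pos (suc i) ℤ* pos c    ≡⟨ rearrange₂ (pos s) (pos c) (pos (suc i)) ⟩
        pos s ℤ* ((- pos c) ℤ* (- pos c)) ℤ+ pos (suc i) ℤ* (- pos c)  ∎
        where
        open ≡-Reasoning
        c = suc c′
        G = progression (s ∸ suc i) c
        rearrange₁ : ∀ g x → g ≡ g ℤ+ x ℤ- x
        rearrange₁ = solve-ℤ
        rearrange₂ : ∀ s c i → s ℤ* (c ℤ* c) ℤ- i ℤ* c ≡ s ℤ* ((- c) ℤ* (- c)) ℤ+ i ℤ* (- c)
        rearrange₂ = solve-ℤ

      weight-ψ-quadForm : pos (weight (built 1) + weight (built 0)) ≡ quadForm t n
      weight-ψ-quadForm = trans (cong pos weight-ψ) (∑≡foldr t summand _ λ p →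
        trans (summand-closed (toℕ p) (toℕ<n p))
          (cong (λ z → pos s ℤ* (z ℤ* z) ℤ+ pos (suc (toℕ p)) ℤ* z) (at-lookup n p)))

    -- The largest element in a pair of classes

    module _ (i : ℕ) (i<t : i < t) where

      lower<M : s ∸ suc i < M
      lower<M = ≤-<-trans (m∸n≤m s (suc i)) s<M

      upper<M : s + suc i < M
      upper<M = subst (s + suc i <_) s+s≡M (+-monoʳ-< s (s≤s i<t))

      base : ℤ
      base = pos (suc i) ℤ- pos s

      base≡ : base ≡ -[1+ t ∸ suc i ]
      base≡ = trans (ℤP.⊖-< (s≤s i<t)) (cong (λ k → - pos k) (sym (suc-∸ i<t)))
        where
        suc-∸ : ∀ {m n} → m < n → suc (n ∸ suc m) ≡ n ∸ m
        suc-∸ m<n = sym (+-∸-assoc 1 m<n)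

      -- Adding `M = s + s` turns `suc i - s` into `s + suc i`, and likewise `- suc i - s` into
      -- `s - suc i`: the residues in `Delta` are the two classes of coordinate `suc i`.
      base-%ℕ : base %ℕ M ≡ s + suc i
      base-%ℕ = trans (cong (_%ℕ M) base≡) (trans (-%ℕ k<M) (begin
        M ∸ suc k                              ≡⟨ cong (_∸ suc k) (sym eq) ⟩
        s + suc i + suc k ∸ suc k              ≡⟨ m+n∸n≡m (s + suc i) (suc k) ⟩
        s + suc i                              ∎))
        where
        open ≡-Reasoning
        k = t ∸ suc i
        k<M : suc k < M
        k<M = s≤s (s≤s (≤-trans (m∸n≤m t (suc i)) (m≤m+n t t)))
        rearrange : ∀ s i k → s + suc i + suc k ≡ s + suc (suc i + k)
        rearrange = solve-∀
        eq : s + suc i + suc k ≡ M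
        eq = trans (rearrange s i k) (trans (cong (λ x → s + suc x) (m+[n∸m]≡n i<t)) s+s≡M)

      neg-base-%ℕ : (- pos (suc i) ℤ- pos s) %ℕ M ≡ s ∸ suc i
      neg-base-%ℕ = trans (-%ℕ (s≤s (s≤s (+-monoˡ-< t i<t)))) ([m+n]∸[o+n]≡m∸o t i t)
        where
        [m+n]∸[o+n]≡m∸o : ∀ m o n → (m + n) ∸ (o + n) ≡ m ∸ o
        [m+n]∸[o+n]≡m∸o m o n = trans (cong₂ _∸_ (+-comm m n) (+-comm o n)) ([m+n]∸[m+o]≡n∸o n m o)

      -- The last element of whichever class is nonempty. With `suc c` elements its position is `c`;
      -- if both classes are empty, the default remains.
      top : ℤ → ℤ
      top (pos zero)    = base
      top (pos (suc c)) = pos (s + suc i + c * M)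
      top -[1+ c ]      = pos (s ∸ suc i + c * M)

      base≤top : ∀ z → base ℤ≤ top z
      base≤top (pos zero)    = ℤP.≤-refl
      base≤top (pos (suc c)) = subst (_ℤ≤ top (pos (suc c))) (sym base≡) -≤+
      base≤top -[1+ c ]      = subst (_ℤ≤ top -[1+ c ]) (sym base≡) -≤+

      ≤-top⁺ : ∀ z {q} → q < z ⁺ → pos (s + suc i + q * M) ℤ≤ top z
      ≤-top⁺ (pos (suc c)) (s≤s q≤c) = pos≤pos (+-monoʳ-≤ (s + suc i) (*-monoˡ-≤ M q≤c))

      ≤-top⁻ : ∀ z {q} → q < z ⁻ → pos (s ∸ suc i + q * M) ℤ≤ top z
      ≤-top⁻ -[1+ c ] (s≤s q≤c) = pos≤pos (+-monoʳ-≤ (s ∸ suc i) (*-monoˡ-≤ M q≤c))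

      Selected : ℕ → Set
      Selected h = (pos h %ℕ M ≡ base %ℕ M) ⊎ (pos h %ℕ M ≡ (- pos (suc i) ℤ- pos s) %ℕ M)

      -- The decision procedure inside `Delta` is local to it, so `sel` is arbitrary here and is
      -- found by unification at the call.
      foldr-selected : (sel : Decidable Selected) → ∀ n {xs} →
        (∀ {h} → h ∈ xs → InDelta n h) → (∀ {h} → InDelta n h → h ∈ xs) →
        foldr _⊔_ base (map pos (filter sel xs)) ≡ top (at n (suc i))
      foldr-selected sel n {xs} sound complete = ℤP.≤-antisym
        (foldr-⊔-lub (filter sel xs) (base≤top z) upper)
        (attained z refl)
        where
        z = at n (suc i)
        upper : ∀ {h} → h ∈ filter sel xs → pos h ℤ≤ top z
        upper {h} h∈ with ∈-filter⁻ sel {xs = xs} h∈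
        ... | h∈xs , sel-h with sound h∈xs
        ... | inDelta q<c with sel-h
        ... | inj₁ r≡ = subst (λ h → pos h ℤ≤ top z)
            (trans (cong (_+ h / M * M) (sym r≡′)) (divMod-eq h))
            (≤-top⁺ z (subst (h / M <_) (trans (cong (charge n) r≡′) (charge-upper n (suc i))) q<c))
          where
          r≡′ : h % M ≡ s + suc i
          r≡′ = trans r≡ base-%ℕ
        ... | inj₂ r≡ = subst (λ h → pos h ℤ≤ top z)
            (trans (cong (_+ h / M * M) (sym r≡′)) (divMod-eq h))
            (≤-top⁻ z (subst (h / M <_) (trans (cong (charge n) r≡′) (charge-lower n (s≤s (<⇒≤ i<t)))) q<c))
          where
          r≡′ : h % M ≡ s ∸ suc i
          r≡′ = trans r≡ neg-base-%ℕ
        -- `w` allows the sign to be analysed while the equation keeps its link to `charge n`.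
        attained : ∀ w → at n (suc i) ≡ w → top w ℤ≤ foldr _⊔_ base (map pos (filter sel xs))
        attained (pos zero) _ = ≤-foldr-⊔ base (filter sel xs)
        attained (pos (suc c)) eq = ∈⇒≤-foldr-⊔ base (∈-filter⁺ sel
          (complete (inDelta⁺ upper<M c n (≤-reflexive (sym (trans (charge-upper n (suc i)) (cong _⁺ eq))))))
          (inj₁ (trans ([r+qM]%M upper<M c) (sym base-%ℕ))))
        attained -[1+ c ] eq = ∈⇒≤-foldr-⊔ base (∈-filter⁺ sel
          (complete (inDelta⁺ lower<M c n
            (≤-reflexive (sym (trans (charge-lower n (s≤s (<⇒≤ i<t))) (cong _⁻ eq))))))
          (inj₂ (trans ([r+qM]%M lower<M c) (sym neg-base-%ℕ))))

      top-formula : ∀ z → pos s ℤ+ top z ≡ sgn z ℤ* (pos (2 * s) ℤ* z ℤ+ pos (suc i))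
      top-formula (pos zero) = rearrange (pos s) (pos (suc i)) (pos (2 * s))
        where
        rearrange : ∀ s i m → s ℤ+ (i ℤ- s) ≡ pos 1 ℤ* (m ℤ* pos 0 ℤ+ i)
        rearrange = solve-ℤ
      top-formula (pos (suc c)) = begin
        pos (s + (s + suc i + c * M))
          ≡⟨ cong pos (trans (cong (λ m → s + (s + suc i + c * m)) (sym s+s≡M)) (rearrange s i c)) ⟩
        pos (2 * s * suc c) ℤ+ pos (suc i)
          ≡⟨ cong (_ℤ+ pos (suc i)) (ℤP.pos-* (2 * s) (suc c)) ⟩
        pos (2 * s) ℤ* pos (suc c) ℤ+ pos (suc i)                ≡⟨ sym (ℤP.*-identityˡ _) ⟩
        pos 1 ℤ* (pos (2 * s) ℤ* pos (suc c) ℤ+ pos (suc i))     ∎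
        where
        open ≡-Reasoning
        rearrange : ∀ s i c → s + (s + suc i + c * (s + s)) ≡ 2 * s * suc c + suc i
        rearrange = solve-∀
      top-formula -[1+ c ] = begin
        pos T                                                          ≡⟨ rearrange₁ (pos T) (pos (suc i)) ⟩
        pos (T + suc i) ℤ- pos (suc i)
          ≡⟨ cong (λ x → pos x ℤ- pos (suc i)) T+i ⟩
        pos (2 * s * suc c) ℤ- pos (suc i)
          ≡⟨ cong (_ℤ- pos (suc i)) (ℤP.pos-* (2 * s) (suc c)) ⟩
        pos (2 * s) ℤ* pos (suc c) ℤ- pos (suc i)
          ≡⟨ rearrange₂ (pos (2 * s)) (pos (suc c)) (pos (suc i)) ⟩
        (- pos 1) ℤ* (pos (2 * s) ℤ* (- pos (suc c)) ℤ+ pos (suc i))   ∎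
        where
        open ≡-Reasoning
        T = s + (s ∸ suc i + c * M)
        rearrange₁ : ∀ x y → x ≡ x ℤ+ y ℤ- y
        rearrange₁ = solve-ℤ
        rearrange₂ : ∀ m c i → m ℤ* c ℤ- i ≡ (- pos 1) ℤ* (m ℤ* (- c) ℤ+ i)
        rearrange₂ = solve-ℤ
        rearrange₃ : ∀ s d c i → s + (d + c * (s + s)) + i ≡ s + (d + i) + c * (s + s)
        rearrange₃ = solve-∀
        rearrange₄ : ∀ s c → s + s + c * (s + s) ≡ 2 * s * suc c
        rearrange₄ = solve-∀
        T+i : T + suc i ≡ 2 * s * suc c
        T+i = begin
          s + (s ∸ suc i + c * M) + suc i
            ≡⟨ cong (λ m → s + (s ∸ suc i + c * m) + suc i) (sym s+s≡M) ⟩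
          s + (s ∸ suc i + c * (s + s)) + suc i        ≡⟨ rearrange₃ s (s ∸ suc i) c (suc i) ⟩
          s + (s ∸ suc i + suc i) + c * (s + s)
            ≡⟨ cong (λ k → s + k + c * (s + s)) (m∸n+n≡m (s≤s (<⇒≤ i<t))) ⟩
          s + s + c * (s + s)                          ≡⟨ rearrange₄ s c ⟩
          2 * s * suc c                                ∎

    -- Equality is meant for partitions, not for the proofs attached to them: the empty partition,
    -- for instance, satisfies both alternatives of `IsDoubledDistinct`.
    ψ∘φ : ∀ x → proj₁ (ψ (φ x)) ≡ proj₁ x
    ψ∘φ x = hooks-injective (ψ (φ x)) x
      (inDelta⇒∈-hooks x ∘ ∈-hooks-ψ⇒inDelta (φ x)) (inDelta⇒∈-hooks-ψ (φ x) ∘ ∈-hooks⇒inDelta x)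

    φ∘ψ : ∀ n → φ (ψ n) ≡ n
    φ∘ψ n = inDelta-injective
      (∈-hooks-ψ⇒inDelta n ∘ inDelta⇒∈-hooks (ψ n)) (∈-hooks⇒inDelta (ψ n) ∘ inDelta⇒∈-hooks-ψ n)

    weight-formula : ∀ x → pos (weight (proj₁ (proj₁ x)) + weight (proj₂ (proj₁ x))) ≡ quadForm t (φ x)
    weight-formula x = trans
      (cong (λ p → pos (weight (proj₁ p) + weight (proj₂ p))) (sym (ψ∘φ x)))
      (weight-ψ-quadForm (φ x))

    delta-formula : ∀ x (p : Fin t) →
      pos s ℤ+ Delta t (proj₁ (proj₁ x)) (proj₂ (proj₁ x)) (suc (toℕ p))
        ≡ sgn (lookup (φ x) p) ℤ* (pos (2 * s) ℤ* lookup (φ x) p ℤ+ pos (suc (toℕ p)))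
    delta-formula x p = begin
      pos s ℤ+ Delta t (proj₁ (proj₁ x)) (proj₂ (proj₁ x)) (suc i)
        ≡⟨ cong (pos s ℤ+_) (foldr-selected i (toℕ<n p) _ (φ x) (∈-hooks⇒inDelta x) (inDelta⇒∈-hooks x)) ⟩
      pos s ℤ+ top i (toℕ<n p) (at (φ x) (suc i))
        ≡⟨ cong (λ z → pos s ℤ+ top i (toℕ<n p) z) (at-lookup (φ x) p) ⟩
      pos s ℤ+ top i (toℕ<n p) (lookup (φ x) p)
        ≡⟨ top-formula i (toℕ<n p) (lookup (φ x) p) ⟩
      sgn (lookup (φ x) p) ℤ* (pos (2 * s) ℤ* lookup (φ x) p ℤ+ pos (suc i)) ∎
      where
      open ≡-Reasoning
      i = toℕ p

open import Data.Nat using (ℕ; suc; _≤_) renaming (_+_ to _ℕ+_; _*_ to _ℕ*_)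
open import Data.Integer using (ℤ; +_; _+_; _*_)
open import Data.Vec using (Vec; lookup)
open import Data.Fin using (Fin; toℕ)
open import Data.Product using (Σ; _×_; _,_; proj₁; proj₂)
open import Relation.Binary.PropositionalEquality using (_≡_)

theorem3p2 : (t : ℕ) → 2 ≤ t →
    Σ (SCDD t → Vec ℤ t) λ φ →
    Σ (Vec ℤ t → SCDD t) λ ψ →
    (∀ x → proj₁ (ψ (φ x)) ≡ proj₁ x)
    × (∀ n → φ (ψ n) ≡ n)
    × (∀ x → + (weight (proj₁ (proj₁ x)) ℕ+ weight (proj₂ (proj₁ x))) ≡ quadForm t (φ x))
    × (∀ x (p : Fin t) →
    + suc t + Delta t (proj₁ (proj₁ x)) (proj₂ (proj₁ x)) (suc (toℕ p))
    ≡ sgn (lookup (φ x) p) * (+ (2 ℕ* suc t) * lookup (φ x) p + + suc (toℕ p)))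
theorem3p2 t _ = φ , ψ , ψ∘φ , φ∘ψ , weight-formula , delta-formula
  where open Cores.Correspondence t
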